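{- Let $d\in\mathbb{N}$ and let $\mathcal C$ be a class of finite graphs (finite $\sigma$-structures, $\sigma=\{E,P_1,\dots,P_N\}$) in which every vertex has degree at most $d$. Then for every order-invariant $\mathsf{CFO}$ sentence $\varphi$ there exists a first-order sentence $\psi$ over $\sigma$ such that for every $\mathcal A\in\mathcal C$: $\mathcal A\models\varphi$ if and only if $\mathcal A\models\psi$. In other words, order-invariant $\mathsf{CFO}$ is included in $\mathsf{FO}$ on $\mathcal C$.
   Context: Graphs are loopless undirected coloured simple graphs, viewed as structures over $\sigma=\{E,P_1,\dots,P_N\}$ with $E$ a binary relation interpreted as a symmetric loopless relation and the $P_\ell$ unary (colours). An ordered graph is a $\sigma\cup\{<\}$-structure where $<$ is a linear order on the vertices. Cluster first-order logic ($\mathsf{CFO}$): fix an infinite alphabet $\Sigma$. Variables are $x_w^i$ for $w\in\Sigma^*$, $i\in\mathbb N$ (variables with the same $w$ form the cluster $w$). For a finite $S\subseteq\Sigma^*\times\mathbb N$ let $X_S=\{x_w^i:(w,i)\in S\}$; $S$ is valid if $(w,i)\in S$ implies $(w,j)\in S$ for all $j<i$, and $(w\alpha,0)\in S$ (with $\alpha\in\Sigma$) implies $(w,0)\in S$. For valid $S$, $\mathsf{CFO}_S[0]$ is the closure under Boolean connectives of the atoms $P_\ell(x_w^i)$, $E(x_w^i,x_w^j)$, $x_w^i\sim x_w^j$, and $x_{w\alpha}^0\sim x_w^i$, for variables in $X_S$ and $\sim\in\{=,<,>\}$. $\mathsf{CFO}_S[k+1]$ is the closure under Boolean connectives of $\mathsf{CFO}_S[0]$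 together with: $\exists x_\epsilon^0\,\psi$ with $\psi\in\mathsf{CFO}_{\{(\epsilon,0)\}}[k]$ (only if $S=\emptyset$); $\exists x_{w\alpha}^0\,\psi$ where $(w,0)\in S$, $(w\alpha,0)\notin S$, $\alpha\in\Sigma$, $\psi\in\mathsf{CFO}_{S\cup\{(w\alpha,0)\}}[k]$; and $\exists x_w^i\,(E(x_w^i,x_w^j)\wedge\psi)$ where $(w,j)\in S$, $i$ is the least index with $(w,i)\notin S$, and $\psi\in\mathsf{CFO}_{S\cup\{(w,i)\}}[k]$. $\mathsf{CFO}=\bigcup_k\mathsf{CFO}_\emptyset[k]$; formulas have the usual first-order semantics over ordered graphs. A $\mathsf{CFO}$ sentence $\varphi$ is order-invariant if for every finite graph $\mathcal A$ and any two linear orders $<_1,<_2$ on its vertex set, $(\mathcal A,<_1)\models\varphi\iff(\mathcal A,<_2)\models\varphi$; in that case one writes $\mathcal A\models\varphi$. -}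

module Defs where

open import Data.Nat using (ℕ; zero; suc; _<_)
open import Data.Fin using (Fin; _≟_) renaming (_<?_ to _<ᶠ?_)
open import Data.Bool using (Bool; true; false; not; _∧_; _∨_)
open import Data.List using (List; []; _∷_; _∷ʳ_; length; filterᵇ; allFin)
open import Data.Bool.ListAction using (any)
open import Data.List.Membership.Propositional using (_∈_; _∉_)
open import Data.List.Relation.Unary.Any using (here; there)
open import Data.Product using (_×_; _,_)
open import Data.Sum using (_⊎_)
open import Relation.Nullary.Decidable using (⌊_⌋)
open import Relation.Binary.PropositionalEquality using (_≡_; _≢_)

record Graph (N n : ℕ) : Set where
  field
    E        : Fin n → Fin n → Bool
    E-sym    : ∀ x y → E x y ≡ E y x
    E-irrefl : ∀ x → E x x ≡ false
    P        : Fin N → Fin n → Bool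
open Graph public

degree : ∀ {N n} → Graph N n → Fin n → ℕ
degree {n = n} G v = length (filterᵇ (E G v) (allFin n))

record LinOrder (n : ℕ) : Set where
  field
    lt       : Fin n → Fin n → Bool
    irrefl   : ∀ x → lt x x ≡ false
    trans    : ∀ x y z → lt x y ≡ true → lt y z ≡ true → lt x z ≡ true
    total    : ∀ x y → x ≢ y → lt x y ≡ true ⊎ lt y x ≡ true
open LinOrder public

exists : ∀ {n} → (Fin n → Bool) → Bool
exists {n} f = any f (allFin n)

-- Cluster first-order logic.  Alphabet Σ = ℕ (infinite); a word is a List ℕ,
-- and wα is  w ∷ʳ α.  Variable x_w^i is the pair (w , i).

Var : Set
Var = List ℕ × ℕ

data Cmp : Set where
  eq lt' gt : Cmp

data Atom (N : ℕ) (S : List Var) : Set where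
  col   : Fin N → (v : Var) → v ∈ S → Atom N S
  edge  : (w : List ℕ) (i j : ℕ) → (w , i) ∈ S → (w , j) ∈ S → Atom N S
  cmp   : Cmp → (w : List ℕ) (i j : ℕ) → (w , i) ∈ S → (w , j) ∈ S → Atom N S
  cmpCh : Cmp → (w : List ℕ) (α i : ℕ) → (w ∷ʳ α , 0) ∈ S → (w , i) ∈ S → Atom N S

-- CFO N S k  is  CFO_S[k]  (formulas are built only from valid S, starting at ∅)
data CFO (N : ℕ) : List Var → ℕ → Set where
  atom  : ∀ {S k} → Atom N S → CFO N S k
  tt    : ∀ {S k} → CFO N S k
  neg   : ∀ {S k} → CFO N S k → CFO N S k
  conj  : ∀ {S k} → CFO N S k → CFO N S k → CFO N S k
  exRoot  : ∀ {k} → CFO N (([] , 0) ∷ []) k → CFO N [] (suc k)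
  exChild : ∀ {S k} (w : List ℕ) (α : ℕ) → (w , 0) ∈ S → (w ∷ʳ α , 0) ∉ S →
            CFO N ((w ∷ʳ α , 0) ∷ S) k → CFO N S (suc k)
  -- ∃ x_w^i (E(x_w^i, x_w^j) ∧ ψ), i least with (w,i) ∉ S
  exNbr   : ∀ {S k} (w : List ℕ) (i j : ℕ) → (w , j) ∈ S →
            (∀ m → m < i → (w , m) ∈ S) → (w , i) ∉ S →
            CFO N ((w , i) ∷ S) k → CFO N S (suc k)

Env : List Var → ℕ → Set
Env S n = (v : Var) → v ∈ S → Fin n

extend : ∀ {S n} {u : Var} → Fin n → Env S n → Env (u ∷ S) n
extend a ρ _ (here _≡_.refl) = a
extend a ρ v (there p)       = ρ v p

evalCmp : ∀ {n} → LinOrder n → Cmp → Fin n → Fin n → Bool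
evalCmp o eq  x y = ⌊ x ≟ y ⌋
evalCmp o lt' x y = lt o x y
evalCmp o gt  x y = lt o y x

evalAtom : ∀ {N n S} → Graph N n → LinOrder n → Env S n → Atom N S → Bool
evalAtom G o ρ (col ℓ v p)           = P G ℓ (ρ v p)
evalAtom G o ρ (edge w i j p q)      = E G (ρ (w , i) p) (ρ (w , j) q)
evalAtom G o ρ (cmp c w i j p q)     = evalCmp o c (ρ (w , i) p) (ρ (w , j) q)
evalAtom G o ρ (cmpCh c w α i p q)   = evalCmp o c (ρ (w ∷ʳ α , 0) p) (ρ (w , i) q)

evalCFO : ∀ {N n S k} → Graph N n → LinOrder n → Env S n → CFO N S k → Bool
evalCFO G o ρ (atom a)     = evalAtom G o ρ a
evalCFO G o ρ tt           = true
evalCFO G o ρ (neg φ)      = not (evalCFO G o ρ φ)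
evalCFO G o ρ (conj φ ψ)   = evalCFO G o ρ φ ∧ evalCFO G o ρ ψ
evalCFO G o ρ (exRoot φ)   = exists λ a → evalCFO G o (extend a ρ) φ
evalCFO G o ρ (exChild w α _ _ φ) = exists λ a → evalCFO G o (extend a ρ) φ
evalCFO G o ρ (exNbr w i j p _ _ φ) =
  exists λ a → E G a (ρ (w , j) p) ∧ evalCFO G o (extend a ρ) φ

emptyEnv : ∀ {n} → Env [] n
emptyEnv v ()

_,_⊨CFO_ : ∀ {N n k} → Graph N n → LinOrder n → CFO N [] k → Bool
G , o ⊨CFO φ = evalCFO G o emptyEnv φ

OrderInvariant : ∀ {N k} → CFO N [] k → Set
OrderInvariant {N} φ =
  ∀ {n} (G : Graph N n) (o₁ o₂ : LinOrder n) → (G , o₁ ⊨CFO φ) ≡ (G , o₂ ⊨CFO φ)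

data FO (N : ℕ) : ℕ → Set where
  E'   : ∀ {m} → Fin m → Fin m → FO N m
  P'   : ∀ {m} → Fin N → Fin m → FO N m
  eq'  : ∀ {m} → Fin m → Fin m → FO N m
  neg' : ∀ {m} → FO N m → FO N m
  and' : ∀ {m} → FO N m → FO N m → FO N m
  ex'  : ∀ {m} → FO N (suc m) → FO N m

extendFO : ∀ {n m} → Fin n → (Fin m → Fin n) → Fin (suc m) → Fin n
extendFO a ρ Fin.zero    = a
extendFO a ρ (Fin.suc x) = ρ x

evalFO : ∀ {N n m} → Graph N n → (Fin m → Fin n) → FO N m → Bool
evalFO G ρ (E' x y)   = E G (ρ x) (ρ y)
evalFO G ρ (P' ℓ x)   = P G ℓ (ρ x)
evalFO G ρ (eq' x y)  = ⌊ ρ x ≟ ρ y ⌋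
evalFO G ρ (neg' φ)   = not (evalFO G ρ φ)
evalFO G ρ (and' φ ψ) = evalFO G ρ φ ∧ evalFO G ρ ψ
evalFO G ρ (ex' φ)    = exists λ a → evalFO G (extendFO a ρ) φ

_⊨FO_ : ∀ {N n} → Graph N n → FO N 0 → Bool
G ⊨FO ψ = evalFO G (λ ()) ψ

{-# OPTIONS --safe #-}
-- Idea.  By order-invariance φ may be evaluated in an order of our choice.  Vertices within
-- distance 2R of each other get different colours from a bounded palette; the order is
-- lexicographic in the colour and in a signed depth.  Only boundedly many vertices have positive
-- depth: the vertices whose coloured R-neighbourhood is rare, which are deepest, and, for each
-- frequent coloured R-neighbourhood, each round i and each sign, a planted copy at the depth of
-- round i, with the copies far apart.  Within a cluster the order is determined by colours.  A
-- new cluster root a is compared with the parent cluster, which contains at most one vertex of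
-- the colour of a; if a is shallow, it can be replaced by the planted copy whose sign yields the
-- same comparison.  By an Ehrenfeucht–Fraïssé argument all quantifiers can thus be restricted to
-- the positive part, a labelled structure of bounded size.  The first-order sentence says that
-- a good structure of this kind, on which the restricted evaluation of φ succeeds, exists.
module Submission where

-- The graph carries no colours of its own, so "a frequent coloured neighbourhood" has no meaning
-- before a colouring is fixed, while the colouring has to suit the planted copies. Templates break
-- this circle: their colours are a prescription, occurrences are sought regardless of colours, and
-- the prescription is imposed only at the planted copies, which are so far apart that the partial
-- colouring stays proper and extends greedily.
--
-- Depth must grow with the rounds because the sign of a vertex decides only against shallower
-- vertices of its colour: a planted reply has to be deeper than every vertex in which the two sides
-- of the game differ so far. Depth changes by at most one along an edge, so the `R`-neighbourhood
-- of a reply is at most `R` deeper than the reply; hence levels are `R + 1` apart. The first level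
-- is `R`, so that the whole neighbourhood of a planted copy is listed.
--
-- The value `R = K * suc K` pays for nesting: a child root found inside the neighbourhood of its
-- parent cluster keeps using that neighbourhood, and a reserve of `K` per remaining round suffices
-- for this.

open import Defs
open import Data.Nat using (ℕ; zero; suc; _+_; _*_; _∸_; _⊓_; _⊔_; _≤_; _<_; z≤n; s≤s; s≤s⁻¹; _≤?_; _<?_)
  renaming (_≟_ to _≟ℕ_)
open import Data.Nat.Properties hiding (_≟_; _≤?_; _<?_)
open import Data.Fin using (Fin; zero; suc; toℕ; fromℕ<; _↑ˡ_; _↑ʳ_; _≟_)
open import Data.Fin.Properties using (any?; all?; ¬∀⟶∃¬; toℕ<n; toℕ-fromℕ<; toℕ-injective)
open import Data.Bool using (Bool; true; false; not; _∧_; T?) renaming (_≟_ to _≟ᵇ_)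
open import Data.Bool.ListAction using (any)
open import Data.Bool.Properties using (T-≡)
open import Data.Empty using (⊥-elim)
open import Data.List using (List; []; _∷_; _∷ʳ_; _++_; length; lookup; map; concatMap; filter;
  filterᵇ; allFin; upTo; cartesianProduct; cartesianProductWith)
open import Data.List.Properties using (≡-dec; ∷ʳ-injectiveˡ; length-++; length-map; length-tabulate)
open import Data.List.Membership.Propositional using (_∈_; _∉_; find; lose)
open import Data.List.Membership.Propositional.Properties using (∈-allFin; ∈-lookup; ∈-∃++; ∈-++⁻;
  ∈-++⁺ˡ; ∈-++⁺ʳ; ∈-map⁺; ∈-map⁻; ∈-filter⁺; ∈-filter⁻; ∈-concatMap⁺; ∈-cartesianProduct⁺;
  ∈-cartesianProductWith⁺; ∈-upTo⁺)
import Data.List.Membership.DecPropositional as DecMembership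
open import Data.List.Relation.Unary.All using ([]; _∷_)
  renaming (lookup to All-lookup; tabulate to All-tabulate)
open import Data.List.Relation.Unary.AllPairs using (AllPairs; []; _∷_)
open import Data.List.Relation.Unary.Any as Any using (Any; here; there; index)
open import Data.List.Relation.Unary.Any.Properties using (lookup-index)
open import Data.List.Relation.Unary.Unique.Propositional using (Unique)
open import Data.List.Relation.Unary.Unique.Propositional.Properties using (allFin⁺; filter⁺)
open import Data.Maybe as Maybe using (Maybe; just; nothing; fromMaybe; maybe)
open import Data.Maybe.Properties using (just-injective)
open import Data.Product using (Σ; ∃; _×_; _,_; proj₁; proj₂)
open import Data.Sum using (_⊎_; inj₁; inj₂)
open import Data.Vec using (Vec; []; _∷_; tabulate) renaming (lookup to infixl 9 _!_)
open import Data.Vec.Properties using (lookup∘tabulate)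
import Data.Vec.Functional as F
open import Data.Vec.Functional.Properties using (lookup-++ˡ; lookup-++ʳ)
open import Function using (_∘_; id; Equivalence)
open import Relation.Nullary using (¬_; Dec; yes; no; Reflects; ofʸ; ofⁿ; proof; contradiction; _because_)
open import Relation.Nullary.Decidable using (⌊_⌋; ¬?; _→-dec_; _×-dec_; _⊎-dec_; decidable-stable; isYes≗does)
open import Relation.Nullary.Reflects using (¬-reflects; _×-reflects_)
open import Relation.Binary using (tri<; tri≈; tri>)
open import Relation.Binary.PropositionalEquality
  using (_≡_; _≢_; refl; sym; cong; cong₂; subst; subst₂) renaming (trans to ≡-trans)

-- Boolean reflection

map-reflects : {A B : Set} {b : Bool} → (A → B) → (B → A) → Reflects A b → Reflects B b
map-reflects f g (ofʸ a)  = ofʸ (f a)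
map-reflects f g (ofⁿ ¬a) = ofⁿ (¬a ∘ g)

reflects-true : {A : Set} {b : Bool} → Reflects A b → A → b ≡ true
reflects-true (ofʸ _)  a = refl
reflects-true (ofⁿ ¬a) a = contradiction a ¬a

true-reflects : {A : Set} {b : Bool} → Reflects A b → b ≡ true → A
true-reflects (ofʸ a) _ = a

bool-ext : {a b : Bool} → (a ≡ true → b ≡ true) → (b ≡ true → a ≡ true) → a ≡ b
bool-ext {true}  {b}     f g = sym (f refl)
bool-ext {false} {true}  f g = g refl
bool-ext {false} {false} f g = refl

any-true : {A : Set} (f : A → Bool) {x : A} {xs : List A} →
           x ∈ xs → f x ≡ true → any f xs ≡ true
any-true f (here refl) fx rewrite fx = refl
any-true f {xs = y ∷ xs} (there x∈) fx with f y
... | true  = refl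
... | false = any-true f x∈ fx

any-witness : {A : Set} (f : A → Bool) (xs : List A) →
              any f xs ≡ true → ∃ λ x → f x ≡ true
any-witness f (x ∷ xs) h with f x in e
... | true  = x , e
... | false = any-witness f xs h

exists-true : ∀ {n} (f : Fin n → Bool) {a} → f a ≡ true → exists f ≡ true
exists-true f {a} = any-true f (∈-allFin a)

exists-witness : ∀ {n} (f : Fin n → Bool) → exists f ≡ true → ∃ λ a → f a ≡ true
exists-witness {n} f = any-witness f (allFin n)

exists-ext : ∀ {m n} {f : Fin m → Bool} {g : Fin n → Bool} →
             (∀ a → f a ≡ true → ∃ λ b → g b ≡ true) →
             (∀ b → g b ≡ true → ∃ λ a → f a ≡ true) → exists f ≡ exists g
exists-ext {f = f} {g} to from = bool-ext
  (λ h → let (a , fa) = exists-witness f h; (b , gb) = to a fa in exists-true g gb)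
  (λ h → let (b , gb) = exists-witness g h; (a , fa) = from b gb in exists-true f fa)

exists-reflects : ∀ {n} {f : Fin n → Bool} {A : Fin n → Set} →
                  (∀ a → Reflects (A a) (f a)) → Reflects (∃ A) (exists f)
exists-reflects {f = f} r with exists f in e
... | true  = let (a , fa) = exists-witness f e in ofʸ (a , true-reflects (r a) fa)
... | false = ofⁿ λ { (a , h) →
  contradiction (≡-trans (sym e) (exists-true f (reflects-true (r a) h))) λ () }

forall-reflects : ∀ {n} {f : Fin n → Bool} {A : Fin n → Set} →
                  (∀ a → Reflects (A a) (f a)) → Reflects (∀ a → A a) (not (exists (not ∘ f)))
forall-reflects {f = f} {A} r =
  map-reflects (λ none a → stable (r a) λ ¬a → none (a , ¬a)) (λ { all (a , ¬a) → ¬a (all a) })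
    (¬-reflects (exists-reflects (λ a → ¬-reflects (r a))))
  where
  stable : {B : Set} {b : Bool} → Reflects B b → ¬ ¬ B → B
  stable (ofʸ b)  _   = b
  stable (ofⁿ ¬b) ¬¬b = contradiction ¬b ¬¬b

-- First-order connectives

module _ {N : ℕ} where

  or' imp' : ∀ {m} → FO N m → FO N m → FO N m
  or' φ ψ  = neg' (and' (neg' φ) (neg' ψ))
  imp' φ ψ = neg' (and' φ (neg' ψ))

  all' : ∀ {m} → FO N (suc m) → FO N m
  all' φ = neg' (ex' (neg' φ))

  -- The syntax has no constants. A quantified equation is available without free variables, and a
  -- universal one also holds in the empty graph.
  top' : ∀ {m} → FO N m
  top' = all' (eq' zero zero)

  -- Conditions on a table are settled while the formula is built and enter it as constants.
  dec' : ∀ {m} {A : Set} → Dec A → FO N m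
  dec' (yes _) = top'
  dec' (no _)  = neg' top'

  lit' : ∀ {m} → Bool → FO N m → FO N m
  lit' true  φ = φ
  lit' false φ = neg' φ

  andOver orOver : ∀ {m} {A : Set} → List A → (A → FO N m) → FO N m
  andOver []       φ = top'
  andOver (x ∷ xs) φ = and' (φ x) (andOver xs φ)
  orOver []       φ = neg' top'
  orOver (x ∷ xs) φ = or' (φ x) (orOver xs φ)

  exBlock : ∀ k {m} → FO N (k + m) → FO N m
  exBlock zero    φ = φ
  exBlock (suc k) φ = exBlock k (ex' φ)

  near' : ∀ {m} → ℕ → Fin m → Fin m → FO N m
  near' zero    i j = eq' i j
  near' (suc r) i j = or' (eq' i j) (ex' (and' (E' (suc i) zero) (near' r zero (suc j))))

  -- A record rather than a synonym: Agda can then infer ρ and φ, as evalFO is not injective.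
  record Expresses {n m : ℕ} (G : Graph N n) (ρ : Fin m → Fin n) (φ : FO N m) (A : Set) : Set where
    constructor expresses
    field reflects : Reflects A (evalFO G ρ φ)
  open Expresses public

  module _ {n m : ℕ} {G : Graph N n} {ρ : Fin m → Fin n} where

    map-expresses : ∀ {φ} {A B : Set} → (A → B) → (B → A) → Expresses G ρ φ A → Expresses G ρ φ B
    map-expresses f g (expresses r) = expresses (map-reflects f g r)

    neg-expresses : ∀ {φ} {A : Set} → Expresses G ρ φ A → Expresses G ρ (neg' φ) (¬ A)
    neg-expresses (expresses r) = expresses (¬-reflects r)

    and-expresses : ∀ {φ ψ} {A B : Set} → Expresses G ρ φ A → Expresses G ρ ψ B →
                    Expresses G ρ (and' φ ψ) (A × B)
    and-expresses (expresses a) (expresses b) = expresses (a ×-reflects b)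

    or-expresses : ∀ {φ ψ} {A B : Set} → Expresses G ρ φ A → Expresses G ρ ψ B →
                   Expresses G ρ (or' φ ψ) (A ⊎ B)
    or-expresses (expresses a) (expresses b) = expresses (or-reflects a b)
      where
      or-reflects : ∀ {A B : Set} {a b} → Reflects A a → Reflects B b →
                    Reflects (A ⊎ B) (not (not a ∧ not b))
      or-reflects (ofʸ a)  _        = ofʸ (inj₁ a)
      or-reflects (ofⁿ _)  (ofʸ b)  = ofʸ (inj₂ b)
      or-reflects (ofⁿ ¬a) (ofⁿ ¬b) = ofⁿ λ { (inj₁ a) → ¬a a ; (inj₂ b) → ¬b b }

    imp-expresses : ∀ {φ ψ} {A B : Set} → Expresses G ρ φ A → Expresses G ρ ψ B →
                    Expresses G ρ (imp' φ ψ) (A → B)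
    imp-expresses (expresses a) (expresses b) = expresses (imp-reflects a b)
      where
      imp-reflects : ∀ {A B : Set} {a b} → Reflects A a → Reflects B b →
                     Reflects (A → B) (not (a ∧ not b))
      imp-reflects (ofⁿ ¬a) _        = ofʸ λ a → contradiction a ¬a
      imp-reflects (ofʸ _)  (ofʸ b)  = ofʸ λ _ → b
      imp-reflects (ofʸ a)  (ofⁿ ¬b) = ofⁿ λ f → ¬b (f a)

    ex-expresses : ∀ {φ} {A : Fin n → Set} → (∀ a → Expresses G (extendFO a ρ) φ (A a)) →
                   Expresses G ρ (ex' φ) (∃ A)
    ex-expresses r = expresses (exists-reflects λ a → reflects (r a))

    all-expresses : ∀ {φ} {A : Fin n → Set} → (∀ a → Expresses G (extendFO a ρ) φ (A a)) →
                    Expresses G ρ (all' φ) (∀ a → A a)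
    all-expresses r = expresses (forall-reflects λ a → reflects (r a))

  module _ {n m : ℕ} {G : Graph N n} {ρ : Fin m → Fin n} where

    eq-expresses : ∀ {i j u v} → ρ i ≡ u → ρ j ≡ v → Expresses G ρ (eq' i j) (u ≡ v)
    eq-expresses {i} {j} refl refl =
      expresses (subst (Reflects _) (sym (isYes≗does (ρ i ≟ ρ j))) (proof (ρ i ≟ ρ j)))

    lit-expresses : ∀ {φ a} (b : Bool) → evalFO G ρ φ ≡ a → Expresses G ρ (lit' b φ) (a ≡ b)
    lit-expresses {φ} true refl with evalFO G ρ φ in e
    ... | true  = expresses (subst (Reflects _) (sym e) (ofʸ refl))
    ... | false = expresses (subst (Reflects _) (sym e) (ofⁿ λ ()))
    lit-expresses {φ} false refl with evalFO G ρ φ in e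
    ... | true  = expresses (subst (Reflects _) (cong not (sym e)) (ofⁿ λ ()))
    ... | false = expresses (subst (Reflects _) (cong not (sym e)) (ofʸ refl))

  module _ {n m : ℕ} {G : Graph N n} {ρ : Fin m → Fin n} where

    top-expresses : {A : Set} → A → Expresses G ρ top' A
    top-expresses a = map-expresses (λ _ → a) (λ _ _ → refl)
                        (all-expresses λ v → eq-expresses {i = zero} {zero} refl refl)

    bot-expresses : {A : Set} → ¬ A → Expresses G ρ (neg' top') A
    bot-expresses ¬a = map-expresses (λ f → ⊥-elim (f ¬a)) (λ a _ → ¬a a)
                         (neg-expresses (top-expresses ¬a))

    dec-expresses : {A : Set} (a? : Dec A) → Expresses G ρ (dec' a?) A
    dec-expresses (yes a) = top-expresses a
    dec-expresses (no ¬a) = bot-expresses ¬a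

    andOver-expresses : {A : Set} {P : A → Set} {φ : A → FO N m} (xs : List A) →
                        (∀ a → Expresses G ρ (φ a) (P a)) →
                        Expresses G ρ (andOver xs φ) (∀ a → a ∈ xs → P a)
    andOver-expresses []       r = top-expresses λ _ ()
    andOver-expresses (x ∷ xs) r =
      map-expresses (λ { (p , ps) _ (here refl) → p ; (p , ps) a (there a∈) → ps a a∈ })
                    (λ ps → ps x (here refl) , λ a a∈ → ps a (there a∈))
                    (and-expresses (r x) (andOver-expresses xs r))

    orOver-expresses : {A : Set} {P : A → Set} {φ : A → FO N m} (xs : List A) →
                       (∀ a → Expresses G ρ (φ a) (P a)) →
                       Expresses G ρ (orOver xs φ) (∃ λ a → a ∈ xs × P a)
    orOver-expresses []       r = bot-expresses λ ()
    orOver-expresses (x ∷ xs) r =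
      map-expresses (λ { (inj₁ p) → x , here refl , p ; (inj₂ (a , a∈ , p)) → a , there a∈ , p })
                    (λ { (a , here refl , p) → inj₁ p ; (a , there a∈ , p) → inj₂ (a , a∈ , p) })
                    (or-expresses (r x) (orOver-expresses xs r))

    andFin-expresses : ∀ {k} {P : Fin k → Set} {φ : Fin k → FO N m} →
                       (∀ i → Expresses G ρ (φ i) (P i)) →
                       Expresses G ρ (andOver (allFin k) φ) (∀ i → P i)
    andFin-expresses {k} r =
      map-expresses (λ ps i → ps i (∈-allFin i)) (λ ps i _ → ps i) (andOver-expresses (allFin k) r)

    orFin-expresses : ∀ {k} {P : Fin k → Set} {φ : Fin k → FO N m} →
                      (∀ i → Expresses G ρ (φ i) (P i)) →
                      Expresses G ρ (orOver (allFin k) φ) (∃ P)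
    orFin-expresses {k} r =
      map-expresses (λ { (i , _ , p) → i , p }) (λ { (i , p) → i , ∈-allFin i , p })
                    (orOver-expresses (allFin k) r)

  -- The hypothesis ranges over all environments with the right values, since environments that
  -- agree pointwise need not be equal as functions.
  exBlock-expresses :
    ∀ k {n m} {G : Graph N n} {ρ : Fin m → Fin n} {φ : FO N (k + m)}
    {A : (Fin k → Fin n) → Set} →
    (∀ y ρ' → (∀ i → ρ' (i ↑ˡ m) ≡ y i) → (∀ i → ρ' (k ↑ʳ i) ≡ ρ i) → Expresses G ρ' φ (A y)) →
    Expresses G ρ (exBlock k φ) (∃ A)
  exBlock-expresses zero {n} {ρ = ρ} r =
    map-expresses (λ a → none , a)
                  (λ { (y , a) → true-reflects (reflects (r none ρ (λ ()) λ _ → refl))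
                                   (reflects-true (reflects (r y ρ (λ ()) λ _ → refl)) a) })
                  (r none ρ (λ ()) λ _ → refl)
    where
    none : Fin 0 → Fin n
    none ()
  exBlock-expresses (suc k) {m = m} {ρ = ρ} {A = A} r =
    map-expresses (λ { (y , a , p) → a F.∷ y , p })
                  (λ { (y , p) → F.tail y , F.head y , uncons y p })
                  (exBlock-expresses k λ y ρ' new old → ex-expresses λ a →
                    r (a F.∷ y) (extendFO a ρ') (λ { zero → refl ; (suc i) → new i }) old)
    where
    -- A only sees y up to pointwise equality, since both sides reflect the same truth value.
    uncons : ∀ y → A y → A (F.head y F.∷ F.tail y)
    uncons y p = true-reflects
      (reflects (r _ (y F.++ ρ)
        (λ { zero → lookup-++ˡ y ρ zero ; (suc i) → lookup-++ˡ y ρ (suc i) }) (lookup-++ʳ y ρ)))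
      (reflects-true (reflects (r y (y F.++ ρ) (lookup-++ˡ y ρ) (lookup-++ʳ y ρ))) p)

-- Cardinalities of lists

unique⊆⇒length≤ : {A : Set} {xs ys : List A} → Unique xs → (∀ {x} → x ∈ xs → x ∈ ys) →
                  length xs ≤ length ys
unique⊆⇒length≤ {xs = []} _ _ = z≤n
unique⊆⇒length≤ {xs = x ∷ xs} (x∉ ∷ u) sub with ∈-∃++ (sub (here refl))
... | as , bs , refl = ≤-trans (s≤s (unique⊆⇒length≤ u sub′))
    (≤-reflexive (≡-trans (cong suc (length-++ as)) (≡-trans (sym (+-suc _ _)) (sym (length-++ as)))))
  where
  sub′ : ∀ {y} → y ∈ xs → y ∈ as ++ bs
  sub′ y∈ with ∈-++⁻ as (sub (there y∈))
  ... | inj₁ p           = ∈-++⁺ˡ p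
  ... | inj₂ (here refl) = contradiction refl (All-lookup x∉ y∈)
  ... | inj₂ (there p)   = ∈-++⁺ʳ as p

unique⇒lookup-injective : {A : Set} {xs : List A} → Unique xs →
                          ∀ {i j} → lookup xs i ≡ lookup xs j → i ≡ j
unique⇒lookup-injective (x∉ ∷ u) {zero}  {zero}  _ = refl
unique⇒lookup-injective (x∉ ∷ u) {zero}  {suc j} e = contradiction e (All-lookup x∉ (∈-lookup j))
unique⇒lookup-injective (x∉ ∷ u) {suc i} {zero}  e = contradiction (sym e) (All-lookup x∉ (∈-lookup i))
unique⇒lookup-injective (x∉ ∷ u) {suc i} {suc j} e = cong suc (unique⇒lookup-injective u e)

length-concatMap≤ : {A B : Set} (f : A → List B) {b : ℕ} → (∀ x → length (f x) ≤ b) →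
                    ∀ xs → length (concatMap f xs) ≤ length xs * b
length-concatMap≤ f h []       = z≤n
length-concatMap≤ f h (x ∷ xs) =
  subst (_≤ _) (sym (length-++ (f x))) (+-mono-≤ (h x) (length-concatMap≤ f h xs))

fresh : ∀ {b} (xs : List (Fin (suc b))) → length xs ≤ b → ∃ λ x → x ∉ xs
fresh {b} xs short with any? (λ x → ¬? (x ∈? xs))
  where open DecMembership (_≟_ {suc b}) using (_∈?_)
... | yes p   = p
... | no none = contradiction
  (≤-trans (subst (_≤ length xs) (length-tabulate id)
     (unique⊆⇒length≤ (allFin⁺ (suc b)) λ {x} _ → decidable-stable (x ∈? xs) λ x∉ → none (x , x∉)))
     short)
  (<-irrefl refl)
  where open DecMembership (_≟_ {suc b}) using (_∈?_)

-- Distances, balls and greedy colouring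

ballSize : ℕ → ℕ → ℕ
ballSize d zero    = 1
ballSize d (suc r) = suc (d * ballSize d r)

module _ {N n : ℕ} (G : Graph N n) where

  data Near : ℕ → Fin n → Fin n → Set where
    stay : ∀ {r u} → Near r u u
    step : ∀ {r u w v} → E G u w ≡ true → Near r w v → Near (suc r) u v

module _ {N n : ℕ} {G : Graph N n} where

  near-mono : ∀ {r s u v} → r ≤ s → Near G r u v → Near G s u v
  near-mono r≤s       stay       = stay
  near-mono (s≤s r≤s) (step e p) = step e (near-mono r≤s p)

  near-trans : ∀ {r s u v w} → Near G r u v → Near G s v w → Near G (r + s) u w
  near-trans {r} {s} stay q = near-mono (m≤n+m s r) q
  near-trans (step e p)   q = step e (near-trans p q)

  near-snoc : ∀ {r u v w} → Near G r u v → E G v w ≡ true → Near G (suc r) u w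
  near-snoc stay       e  = step e stay
  near-snoc (step f p) e  = step f (near-snoc p e)

  near-sym : ∀ {r u v} → Near G r u v → Near G r v u
  near-sym stay                   = stay
  near-sym (step {u = u} {w} e p) = near-snoc (near-sym p) (≡-trans (E-sym G w u) e)

  near-lipschitz : {f : Fin n → ℕ} → (∀ {u v} → E G u v ≡ true → f u ≤ suc (f v)) →
                   ∀ {r u v} → Near G r u v → f u ≤ r + f v
  near-lipschitz {f} lip {r} {u} stay = m≤n+m (f u) r
  near-lipschitz lip (step e p)       = ≤-trans (lip e) (s≤s (near-lipschitz lip p))

  near-zero : ∀ {u v} → Near G 0 u v → u ≡ v
  near-zero stay = refl

  near-suc : ∀ {r u v} → Near G (suc r) u v → u ≡ v ⊎ ∃ λ w → E G u w ≡ true × Near G r w v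
  near-suc stay               = inj₁ refl
  near-suc (step {w = w} e p) = inj₂ (w , e , p)

  near-expresses : ∀ {m} {ρ : Fin m → Fin n} {i j u v} r → ρ i ≡ u → ρ j ≡ v →
                   Expresses G ρ (near' r i j) (Near G r u v)
  near-expresses zero refl refl =
    map-expresses (λ e → subst (Near G 0 _) e stay) near-zero (eq-expresses refl refl)
  near-expresses (suc r) refl refl =
    map-expresses (λ { (inj₁ e) → subst (Near G (suc r) _) e stay ; (inj₂ (w , e , p)) → step e p })
                  near-suc
                  (or-expresses (eq-expresses refl refl)
                    (ex-expresses λ w → and-expresses (lit-expresses true refl)
                                                      (near-expresses r refl refl)))

  opaque
    -- The decision is the truth value of the formula `near'` itself; it is opaque so that type
    -- checking never unfolds the search.
    near? : ∀ r u v → Dec (Near G r u v)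
    near? r u v = _ because reflects (near-expresses {ρ = ρ} {zero} {suc zero} r refl refl)
      where
      ρ : Fin 2 → Fin n
      ρ zero       = u
      ρ (suc zero) = v

  -- descend e r u v = r + e - dist(u,v), truncated to lie between 0 and e.
  descend : ℕ → ℕ → Fin n → Fin n → ℕ
  descend zero    r u v = 0
  descend (suc e) r u v with near? r u v
  ... | yes _ = suc e
  ... | no _  = descend e (suc r) u v

  descend≤ : ∀ e r u v → descend e r u v ≤ e
  descend≤ zero    r u v = z≤n
  descend≤ (suc e) r u v with near? r u v
  ... | yes _ = ≤-refl
  ... | no _  = m≤n⇒m≤1+n (descend≤ e (suc r) u v)

  descend-near : ∀ e {r u v} → Near G r u v → descend e r u v ≡ e
  descend-near zero    p = refl
  descend-near (suc e) {r} {u} {v} p with near? r u v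
  ... | yes _ = refl
  ... | no ¬p = contradiction p ¬p

  descend-lipschitz : ∀ e r {u v w} → E G v w ≡ true → descend e r u v ≤ suc (descend e r u w)
  descend-lipschitz zero    r _ = z≤n
  descend-lipschitz (suc e) r {u} {v} {w} vw with near? r u v | near? r u w
  ... | yes _ | yes _ = n≤1+n _
  ... | yes p | no _  = s≤s (≤-reflexive (sym (descend-near e (near-snoc p vw))))
  ... | no _  | yes _ = ≤-trans (descend≤ e (suc r) u v) (m≤n⇒m≤1+n (n≤1+n e))
  ... | no _  | no _  = descend-lipschitz e (suc r) vw

  descend-pos : ∀ e r {u v} → 0 < descend e r u v → ∃ λ s → s < r + e × Near G s u v
  descend-pos (suc e) r {u} {v} pos with near? r u v
  ... | yes p = r , m<m+n r (s≤s z≤n) , p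
  ... | no _  = let (s , s< , q) = descend-pos e (suc r) pos
                in s , subst (s <_) (sym (+-suc r e)) s< , q

  bump : ℕ → Fin n → Fin n → ℕ
  bump h = descend h 0

  bump-pos : ∀ {h u v} → 0 < bump h u v → Near G h u v
  bump-pos {h} pos = let (s , s<h , p) = descend-pos h 0 pos in near-mono (<⇒≤ s<h) p

  ball : ℕ → Fin n → List (Fin n)
  ball zero    u = u ∷ []
  ball (suc r) u = u ∷ concatMap (ball r) (filterᵇ (E G u) (allFin n))

  near⇒∈ball : ∀ {r u v} → Near G r u v → v ∈ ball r u
  near⇒∈ball {zero}  stay = here refl
  near⇒∈ball {suc r} stay = here refl
  near⇒∈ball {suc r} {u} {v} (step {w = w} e p) = there (∈-concatMap⁺ (ball r)
    (lose (∈-filter⁺ (T? ∘ E G u) (∈-allFin w) (Equivalence.from T-≡ e)) (near⇒∈ball p)))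

  module _ {d : ℕ} (deg : ∀ v → degree G v ≤ d) where

    length-ball : ∀ r u → length (ball r u) ≤ ballSize d r
    length-ball zero    u = ≤-refl
    length-ball (suc r) u = s≤s (≤-trans (length-concatMap≤ (ball r) (length-ball r)
                                                            (filterᵇ (E G u) (allFin n)))
                                         (*-monoˡ-≤ (ballSize d r) (deg u)))

  Colouring : Set → Set
  Colouring C = Fin n → Maybe C

  Proper : {C : Set} → ℕ → Colouring C → Set
  Proper r pc = ∀ {u v x} → pc u ≡ just x → pc v ≡ just x → Near G r u v → u ≡ v

  module _ {r b : ℕ} (small : ∀ v → length (ball r v) ≤ b) where

    private
      C = Fin (suc b)

    _⊑_ : Colouring C → Colouring C → Set
    pc ⊑ pc′ = ∀ {v x} → pc v ≡ just x → pc′ v ≡ just x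

    -- The greedy step: the `r`-ball around `v` blocks at most `b` of the `suc b` colours.
    colourOne : ∀ v (pc : Colouring C) → Proper r pc →
                Σ (Colouring C) λ pc′ → pc ⊑ pc′ × Proper r pc′ × ∃ λ x → pc′ v ≡ just x
    colourOne v pc proper with pc v in pcv
    ... | just x  = pc , (λ e → e) , proper , x , pcv
    ... | nothing = pc′ , extends , proper′ , x₀ , pc′v
      where
      colourOf : Fin n → C
      -- An uncoloured vertex counts as coloured `zero`. This may block one colour in vain, but the
      -- list of blocked colours keeps the length of the ball.
      colourOf u = fromMaybe zero (pc u)

      unused = fresh (map colourOf (ball r v))
                     (subst (_≤ b) (sym (length-map colourOf (ball r v))) (small v))
      x₀ = proj₁ unused

      x₀-free : ∀ {u} → Near G r v u → pc u ≢ just x₀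
      x₀-free {u} p pcu = proj₂ unused
        (subst (_∈ _) (cong (fromMaybe zero) pcu) (∈-map⁺ colourOf (near⇒∈ball p)))

      pc′ : Colouring C
      pc′ u with u ≟ v
      ... | yes _ = just x₀
      ... | no _  = pc u

      pc′v : pc′ v ≡ just x₀
      pc′v with v ≟ v
      ... | yes _ = refl
      ... | no ¬p = contradiction refl ¬p

      extends : pc ⊑ pc′
      extends {u} e with u ≟ v
      ... | yes refl = contradiction (≡-trans (sym e) pcv) λ ()
      ... | no _     = e

      proper′ : Proper r pc′
      proper′ {u} {w} eu ew p with u ≟ v | w ≟ v
      ... | yes refl | yes refl = refl
      ... | yes refl | no _     = contradiction (≡-trans ew (sym eu)) (x₀-free p)
      ... | no _     | yes refl = contradiction (≡-trans eu (sym ew)) (x₀-free (near-sym p))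
      ... | no _     | no _     = proper eu ew p

    colourMany : ∀ (vs : List (Fin n)) (pc : Colouring C) → Proper r pc →
                 Σ (Colouring C) λ pc′ → pc ⊑ pc′ × Proper r pc′ ×
                                         (∀ {v} → v ∈ vs → ∃ λ x → pc′ v ≡ just x)
    colourMany []       pc proper = pc , (λ e → e) , proper , λ ()
    colourMany (v ∷ vs) pc proper =
      let (pc₁ , sub₁ , proper₁ , x , v↦x) = colourOne v pc proper
          (pc₂ , sub₂ , proper₂ , def)     = colourMany vs pc₁ proper₁
      in pc₂ , (λ e → sub₂ (sub₁ e)) , proper₂ ,
         λ { (here refl) → x , sub₂ v↦x ; (there v∈) → def v∈ }

    opaque
      extendColouring : (pc : Colouring C) → Proper r pc →
                        Σ (Fin n → C) λ col → (∀ {v x} → pc v ≡ just x → col v ≡ x) ×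
                                              (∀ {u v} → col u ≡ col v → Near G r u v → u ≡ v)
      extendColouring pc proper =
        let (pc′ , sub , proper′ , def) = colourMany (allFin n) pc proper
            total = λ v → def (∈-allFin v)
        in (λ v → proj₁ (total v)) ,
           (λ {v} e → just-injective (≡-trans (sym (proj₂ (total v))) (sub e))) ,
           λ {u} {v} e p → proper′ (proj₂ (total u)) (≡-trans (proj₂ (total v)) (cong just (sym e))) p

-- Finite tables and their enumeration

vectors : {A : Set} → List A → ∀ m → List (Vec A m)
vectors xs zero    = [] ∷ []
vectors xs (suc m) = cartesianProductWith _∷_ xs (vectors xs m)

∈-vectors : {A : Set} {xs : List A} → (∀ a → a ∈ xs) → ∀ {m} (v : Vec A m) → v ∈ vectors xs m
∈-vectors all []      = here refl
∈-vectors all (a ∷ v) = ∈-cartesianProductWith⁺ _∷_ (all a) (∈-vectors all v)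

bools : List Bool
bools = true ∷ false ∷ []

∈-bools : ∀ b → b ∈ bools
∈-bools true  = here refl
∈-bools false = there (here refl)

-- A table is a graph on Fin m whose vertices carry a rank, a hue and a side.
module Tables (N top hues : ℕ) where

  Row : ℕ → Set
  Row m = Vec Bool m × Vec Bool N × Fin (suc top) × Fin hues × Bool

  Table : ℕ → Set
  Table m = Vec (Row m) m

  tables : ∀ m → List (Table m)
  tables m = vectors
    (cartesianProduct (vectors bools m) (cartesianProduct (vectors bools N)
      (cartesianProduct (allFin (suc top)) (cartesianProduct (allFin hues) bools)))) m

  ∈-tables : ∀ {m} (D : Table m) → D ∈ tables m
  ∈-tables = ∈-vectors λ (e , p , r , h , s) →
    ∈-cartesianProduct⁺ (∈-vectors ∈-bools e) (∈-cartesianProduct⁺ (∈-vectors ∈-bools p)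
      (∈-cartesianProduct⁺ (∈-allFin r) (∈-cartesianProduct⁺ (∈-allFin h) (∈-bools s))))

  module _ {m : ℕ} (D : Table m) where

    adj : Fin m → Fin m → Bool
    adj p q = proj₁ (D ! p) ! q

    pred : Fin N → Fin m → Bool
    pred ℓ p = proj₁ (proj₂ (D ! p)) ! ℓ

    rank : Fin m → ℕ
    rank p = toℕ (proj₁ (proj₂ (proj₂ (D ! p))))

    rank≤top : ∀ p → rank p ≤ top
    rank≤top p = s≤s⁻¹ (toℕ<n (proj₁ (proj₂ (proj₂ (D ! p)))))

    hue : Fin m → Fin hues
    hue p = proj₁ (proj₂ (proj₂ (proj₂ (D ! p))))

    side : Fin m → Bool
    side p = proj₂ (proj₂ (proj₂ (proj₂ (D ! p))))

  module MakeTable {m : ℕ} (e : Fin m → Fin m → Bool) (c : Fin N → Fin m → Bool)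
                   (r : Fin m → ℕ) (r≤ : ∀ p → r p ≤ top) (h : Fin m → Fin hues)
                   (s : Fin m → Bool) where

    private
      row : Fin m → Row m
      row p = tabulate (e p) , tabulate (λ ℓ → c ℓ p) , fromℕ< (s≤s (r≤ p)) , h p , s p

    table : Table m
    table = tabulate row

    adj-table : ∀ p q → adj table p q ≡ e p q
    adj-table p q = ≡-trans (cong (λ w → proj₁ w ! q) (lookup∘tabulate row p))
                            (lookup∘tabulate (e p) q)

    pred-table : ∀ ℓ p → pred table ℓ p ≡ c ℓ p
    pred-table ℓ p = ≡-trans (cong (λ w → proj₁ (proj₂ w) ! ℓ) (lookup∘tabulate row p))
                             (lookup∘tabulate (λ ℓ → c ℓ p) ℓ)

    rank-table : ∀ p → rank table p ≡ r p
    rank-table p = ≡-trans (cong (λ w → toℕ (proj₁ (proj₂ (proj₂ w)))) (lookup∘tabulate row p))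
                           (toℕ-fromℕ< (s≤s (r≤ p)))

    hue-table : ∀ p → hue table p ≡ h p
    hue-table p = cong (λ w → proj₁ (proj₂ (proj₂ (proj₂ w)))) (lookup∘tabulate row p)

    side-table : ∀ p → side table p ≡ s p
    side-table p = cong (λ w → proj₂ (proj₂ (proj₂ (proj₂ w)))) (lookup∘tabulate row p)

  -- The rank of a vertex is a radius within which its neighbourhood is listed completely.
  record Embedding {m n : ℕ} (G : Graph N n) (D : Table m) (x : Fin m → Fin n) : Set where
    constructor embedding
    field
      injective : ∀ p q → x p ≡ x q → p ≡ q
      adj-≡     : ∀ p q → E G (x p) (x q) ≡ adj D p q
      pred-≡    : ∀ ℓ p → P G ℓ (x p) ≡ pred D ℓ p
      closed    : ∀ p → 0 < rank D p → ∀ v → E G (x p) v ≡ true →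
                  ∃ λ q → x q ≡ v × rank D p ≤ suc (rank D q)

  embedding' : ∀ {m M} → Table m → (Fin m → Fin M) → FO N M
  embedding' {m} D X =
    and' (andOver (allFin m) λ p → andOver (allFin m) λ q → imp' (eq' (X p) (X q)) (dec' (p ≟ q)))
    (and' (andOver (allFin m) λ p → andOver (allFin m) λ q → lit' (adj D p q) (E' (X p) (X q)))
    (and' (andOver (allFin N) λ ℓ → andOver (allFin m) λ p → lit' (pred D ℓ p) (P' ℓ (X p)))
          (andOver (allFin m) λ p → imp' (dec' (0 <? rank D p))
            (all' (imp' (lit' true (E' (suc (X p)) zero))
              (orOver (allFin m) λ q → and' (eq' (suc (X q)) zero)
                                            (dec' (rank D p ≤? suc (rank D q)))))))))

  embedding-expresses :
    ∀ {m M n} {G : Graph N n} {ρ : Fin M → Fin n} (D : Table m) {X x} → (∀ p → ρ (X p) ≡ x p) →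
    Expresses G ρ (embedding' D X) (Embedding G D x)
  embedding-expresses {G = G} D X≡ =
    map-expresses (λ (i , a , c , cl) → embedding i a c cl)
                  (λ (embedding i a c cl) → i , a , c , cl)
      (and-expresses (andFin-expresses λ p → andFin-expresses λ q →
         imp-expresses (eq-expresses (X≡ p) (X≡ q)) (dec-expresses (p ≟ q)))
      (and-expresses (andFin-expresses λ p → andFin-expresses λ q →
         lit-expresses (adj D p q) (cong-E (X≡ p) (X≡ q)))
      (and-expresses (andFin-expresses λ ℓ → andFin-expresses λ p →
         lit-expresses (pred D ℓ p) (cong (P G ℓ) (X≡ p)))
      (andFin-expresses λ p → imp-expresses (dec-expresses (0 <? rank D p))
        (all-expresses λ v → imp-expresses (lit-expresses true (cong-E (X≡ p) refl))
          (orFin-expresses λ q → and-expresses (eq-expresses (X≡ q) refl)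
                                               (dec-expresses (rank D p ≤? suc (rank D q)))))))))
    where
    cong-E : ∀ {u u′ v v′} → u ≡ u′ → v ≡ v′ → E G u v ≡ E G u′ v′
    cong-E refl refl = refl

  Code : Set
  Code = Σ ℕ λ m → Table m × Fin m

  codes : ℕ → List Code
  codes b = concatMap (λ m → cartesianProductWith (λ D r → m , D , r) (tables m) (allFin m))
                      (upTo (suc b))

  ∈-codes : ∀ {b m} → m ≤ b → (D : Table m) (r : Fin m) → (m , D , r) ∈ codes b
  ∈-codes {b} {m} m≤b D r = ∈-concatMap⁺
    (λ m → cartesianProductWith (λ D r → m , D , r) (tables m) (allFin m))
    (lose (∈-upTo⁺ (s≤s m≤b))
          (∈-cartesianProductWith⁺ (λ D r → m , D , r) (∈-tables D) (∈-allFin r)))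

  -- Templates, rarity and good tables

  module Templates (rounds R : ℕ) where

    -- The hues occur only through their injectivity: the vertices `y t` need not have these
    -- colours. They receive them if the realisation is chosen for planting.
    record Realises {n : ℕ} (G : Graph N n) (q : Code) (y : Fin (proj₁ q) → Fin n) : Set where
      constructor realises
      private
        D    = proj₁ (proj₂ q)
        root = proj₂ (proj₂ q)
      field
        embeds  : Embedding G D y
        hue-inj : ∀ s t → hue D s ≡ hue D t → s ≡ t
        nearby  : ∀ t → Near G R (y root) (y t)

    realises' : ∀ {M} (q : Code) → (Fin (proj₁ q) → Fin M) → FO N M
    realises' (m , D , root) Y =
      and' (embedding' D Y)
      (and' (andOver (allFin m) λ s → andOver (allFin m) λ t →
               dec' ((hue D s ≟ hue D t) →-dec (s ≟ t)))
            (andOver (allFin m) λ t → near' R (Y root) (Y t)))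

    realises-expresses :
      ∀ {M n} {G : Graph N n} {ρ : Fin M → Fin n} (q : Code) {Y y} → (∀ t → ρ (Y t) ≡ y t) →
      Expresses G ρ (realises' q Y) (Realises G q y)
    realises-expresses (m , D , root) Y≡ =
      map-expresses (λ (e , h , n) → realises e h n) (λ (realises e h n) → e , h , n)
        (and-expresses (embedding-expresses D Y≡)
        (and-expresses (andFin-expresses λ s → andFin-expresses λ t → dec-expresses _)
                       (andFin-expresses λ t → near-expresses R (Y≡ root) (Y≡ t))))

    opaque
      realisedAt? : ∀ {n} (G : Graph N n) (q : Code) (v : Fin n) →
                    Dec (∃ λ y → Realises G q y × y (proj₂ (proj₂ q)) ≡ v)
      realisedAt? {n} G q@(m , D , root) v = _ because
        reflects (exBlock-expresses m {m = 1} {ρ = λ _ → v}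
          λ y ρ new old → and-expresses (realises-expresses q new) (eq-expresses (new root) (old zero)))

    -- The rank at which the i-th round of the game finds its answers.
    level : ℕ → ℕ
    level i = R + i * suc R

    module _ {m n : ℕ} (G : Graph N n) (D : Table m) (x : Fin m → Fin n) where

      -- No counting is involved: a template is rare as soon as the table catches all its
      -- occurrences at the highest rank, and the bounded size of the table takes the place of a
      -- threshold.
      Rare : Code → Set
      Rare q@(_ , _ , root) =
        ¬ ∃ λ y → Realises G q y × ¬ ∃ λ p → x p ≡ y root × top ≤ rank D p

      record Planted (q : Code) (i : Fin rounds) (s : Bool) (y : Fin (proj₁ q) → Fin n) : Set where
        constructor planted
        field
          realised : Realises G q y
          placed   : ∃ λ p → x p ≡ y (proj₂ (proj₂ q)) ×
                             rank D p ≡ level (toℕ i) × side D p ≡ s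
          coloured : ∀ t → ∃ λ p → x p ≡ y t × hue D p ≡ hue (proj₁ (proj₂ q)) t

      record Good (cs : List Code) : Set where
        constructor good
        field
          embeds : Embedding G D x
          proper : ∀ p q → Near G (R + R) (x p) (x q) → hue D p ≡ hue D q → p ≡ q
          coded  : ∀ q → q ∈ cs → Rare q ⊎ (∀ i s → s ∈ bools → ∃ (Planted q i s))

    rare' : ∀ {m M} → Table m → (Fin m → Fin M) → Code → FO N M
    rare' {m} {M} D X q@(k , _ , root) =
      neg' (exBlock k (and' (realises' q (_↑ˡ M))
        (neg' (orOver (allFin m) λ p → and' (eq' (k ↑ʳ X p) (root ↑ˡ M)) (dec' (top ≤? rank D p))))))

    planted' : ∀ {m M} → Table m → (Fin m → Fin M) → Code → Fin rounds → Bool → FO N M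
    planted' {m} {M} D X q@(k , C , root) i s =
      exBlock k (and' (realises' q (_↑ˡ M)) (and'
        (orOver (allFin m) λ p → and' (eq' (k ↑ʳ X p) (root ↑ˡ M))
          (dec' ((rank D p ≟ℕ level (toℕ i)) ×-dec (side D p ≟ᵇ s))))
        (andOver (allFin k) λ t → orOver (allFin m) λ p →
          and' (eq' (k ↑ʳ X p) (t ↑ˡ M)) (dec' (hue D p ≟ hue C t)))))

    good' : ∀ {m M} → Table m → (Fin m → Fin M) → List Code → FO N M
    good' {m} D X cs =
      and' (embedding' D X)
      (and' (andOver (allFin m) λ p → andOver (allFin m) λ q →
               imp' (near' (R + R) (X p) (X q)) (dec' ((hue D p ≟ hue D q) →-dec (p ≟ q))))
            (andOver cs λ q → or' (rare' D X q)
               (andOver (allFin rounds) λ i → andOver bools λ s → planted' D X q i s)))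

    good-expresses :
      ∀ {m M n} {G : Graph N n} {ρ : Fin M → Fin n} (D : Table m) {X x} cs →
      (∀ p → ρ (X p) ≡ x p) → Expresses G ρ (good' D X cs) (Good G D x cs)
    good-expresses {m} {M} {n} {G} {ρ} D {X} {x} cs X≡ =
      map-expresses (λ (e , p , c) → good e p c) (λ (good e p c) → e , p , c)
        (and-expresses (embedding-expresses D X≡)
        (and-expresses (andFin-expresses λ p → andFin-expresses λ q →
                          imp-expresses (near-expresses (R + R) (X≡ p) (X≡ q)) (dec-expresses _))
        (andOver-expresses cs λ q → or-expresses (rare-expresses q)
          (andFin-expresses λ i → andOver-expresses bools λ s → planted-expresses q i s))))
      where
      rare-expresses : ∀ q → Expresses G ρ (rare' D X q) (Rare G D x q)
      rare-expresses q@(k , _ , root) = neg-expresses (exBlock-expresses k λ y ρ' new old →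
        and-expresses (realises-expresses q new) (neg-expresses (orFin-expresses λ p →
          and-expresses (eq-expresses (≡-trans (old (X p)) (X≡ p)) (new root)) (dec-expresses _))))

      planted-expresses : ∀ q i s → Expresses G ρ (planted' D X q i s) (∃ (Planted G D x q i s))
      planted-expresses q@(k , _ , root) i s = exBlock-expresses k λ y ρ' new old →
        map-expresses (λ (r , l , c) → planted r l c) (λ (planted r l c) → r , l , c)
          (and-expresses (realises-expresses q new) (and-expresses
            (orFin-expresses λ p → and-expresses
              (eq-expresses (≡-trans (old (X p)) (X≡ p)) (new root)) (dec-expresses _))
            (andFin-expresses λ t → orFin-expresses λ p → and-expresses
              (eq-expresses (≡-trans (old (X p)) (X≡ p)) (new t)) (dec-expresses _))))

-- Lexicographic order on keys

lexStep : ℕ → ℕ → Bool → Bool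
lexStep x y b with <-cmp x y
... | tri< _ _ _ = true
... | tri≈ _ _ _ = b
... | tri> _ _ _ = false

lexStep-< : ∀ {x y b} → x < y → lexStep x y b ≡ true
lexStep-< {x} {y} x<y with <-cmp x y
... | tri< _ _ _   = refl
... | tri≈ ¬< _ _  = contradiction x<y ¬<
... | tri> ¬< _ _  = contradiction x<y ¬<

lexStep-≡ : ∀ {x y b} → x ≡ y → lexStep x y b ≡ b
lexStep-≡ {x} {y} x≡y with <-cmp x y
... | tri< _ ¬≡ _ = contradiction x≡y ¬≡
... | tri≈ _ _ _  = refl
... | tri> _ ¬≡ _ = contradiction x≡y ¬≡

lexStep-true : ∀ {x y b} → lexStep x y b ≡ true → x < y ⊎ (x ≡ y × b ≡ true)
lexStep-true {x} {y} h with <-cmp x y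
... | tri< x<y _ _ = inj₁ x<y
... | tri≈ _ x≡y _ = inj₂ (x≡y , h)

lexStep-trans : ∀ {x y z b c d} → (b ≡ true → c ≡ true → d ≡ true) →
                lexStep x y b ≡ true → lexStep y z c ≡ true → lexStep x z d ≡ true
lexStep-trans {x} {y} {z} bcd xy yz with lexStep-true {x} {y} xy | lexStep-true {y} {z} yz
... | inj₁ x<y        | inj₁ y<z        = lexStep-< (<-trans x<y y<z)
... | inj₁ x<y        | inj₂ (refl , _) = lexStep-< x<y
... | inj₂ (refl , _) | inj₁ y<z        = lexStep-< y<z
... | inj₂ (refl , b) | inj₂ (refl , c) = ≡-trans (lexStep-≡ {x} refl) (bcd b c)

lexStep-total : ∀ x y {b c} → b ≡ true ⊎ c ≡ true →
                lexStep x y b ≡ true ⊎ lexStep y x c ≡ true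
lexStep-total x y bc with <-cmp x y
lexStep-total x y bc        | tri< x<y _ _ = inj₁ refl
lexStep-total x y (inj₁ b)  | tri≈ _ x≡y _ = inj₁ b
lexStep-total x y (inj₂ c)  | tri≈ _ x≡y _ = inj₂ (≡-trans (lexStep-≡ (sym x≡y)) c)
lexStep-total x y bc        | tri> _ _ y<x = inj₂ (lexStep-< y<x)

Key : Set
Key = ℕ × ℕ × ℕ

precedes : Key → Key → Bool
precedes (a , b , c) (a′ , b′ , c′) = lexStep a a′ (lexStep b b′ (lexStep c c′ false))

precedes-trans : ∀ k k′ k″ → precedes k k′ ≡ true → precedes k′ k″ ≡ true → precedes k k″ ≡ true
precedes-trans (a , b , c) (a′ , b′ , c′) (a″ , b″ , c″) =
  lexStep-trans {a} {a′} {a″} (lexStep-trans {b} {b′} {b″} (lexStep-trans {c} {c′} {c″} λ ()))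

precedes-irrefl : ∀ k → precedes k k ≡ false
precedes-irrefl (a , b , c) =
  ≡-trans (lexStep-≡ {a} refl) (≡-trans (lexStep-≡ {b} refl) (lexStep-≡ {c} refl))

precedes-total : ∀ k k′ → proj₂ (proj₂ k) ≢ proj₂ (proj₂ k′) →
                 precedes k k′ ≡ true ⊎ precedes k′ k ≡ true
precedes-total (a , b , c) (a′ , b′ , c′) c≢c′ =
  lexStep-total a a′ (lexStep-total b b′ ties)
  where
  ties : lexStep c c′ false ≡ true ⊎ lexStep c′ c false ≡ true
  ties with <-cmp c c′
  ... | tri< _ _ _    = inj₁ refl
  ... | tri≈ _ c≡c′ _ = contradiction c≡c′ c≢c′
  ... | tri> _ _ c′<c = inj₂ (lexStep-< c′<c)

keyOrder : ∀ {n} (key : Fin n → Key) →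
           (∀ {u v} → proj₂ (proj₂ (key u)) ≡ proj₂ (proj₂ (key v)) → u ≡ v) → LinOrder n
keyOrder key inj = record
  { lt     = λ u v → precedes (key u) (key v)
  ; irrefl = λ u → precedes-irrefl (key u)
  ; trans  = λ u v w → precedes-trans (key u) (key v) (key w)
  ; total  = λ u v u≢v → precedes-total (key u) (key v) (u≢v ∘ inj)
  }

-- Comparisons in a fixed order

module _ {n : ℕ} (o : LinOrder n) where

  SameCmp : (u v u′ v′ : Fin n) → Set
  SameCmp u v u′ v′ = ∀ c → evalCmp o c u v ≡ evalCmp o c u′ v′

  private
    lt⇒≢ : ∀ {u v} → lt o u v ≡ true → ⌊ u ≟ v ⌋ ≡ false
    lt⇒≢ {u} {v} u<v with u ≟ v
    ... | yes refl = contradiction (≡-trans (sym u<v) (irrefl o u)) λ ()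
    ... | no _     = refl

    lt⇒≢′ : ∀ {u v} → lt o u v ≡ true → ⌊ v ≟ u ⌋ ≡ false
    lt⇒≢′ {u} {v} u<v with v ≟ u
    ... | yes refl = contradiction (≡-trans (sym u<v) (irrefl o u)) λ ()
    ... | no _     = refl

    lt⇒≯ : ∀ {u v} → lt o u v ≡ true → lt o v u ≡ false
    lt⇒≯ {u} {v} u<v with lt o v u in v<u
    ... | true  = contradiction (≡-trans (sym (trans o u v u u<v v<u)) (irrefl o u)) λ ()
    ... | false = refl

  same-lt : ∀ {u v u′ v′} → lt o u v ≡ true → lt o u′ v′ ≡ true → SameCmp u v u′ v′
  same-lt p q eq  = ≡-trans (lt⇒≢ p) (sym (lt⇒≢ q))
  same-lt p q lt' = ≡-trans p (sym q)
  same-lt p q gt  = ≡-trans (lt⇒≯ p) (sym (lt⇒≯ q))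

  same-gt : ∀ {u v u′ v′} → lt o v u ≡ true → lt o v′ u′ ≡ true → SameCmp u v u′ v′
  same-gt p q eq  = ≡-trans (lt⇒≢′ p) (sym (lt⇒≢′ q))
  same-gt p q lt' = ≡-trans (lt⇒≯ p) (sym (lt⇒≯ q))
  same-gt p q gt  = ≡-trans p (sym q)

  same-eq : ∀ u u′ → SameCmp u u u′ u′
  same-eq u u′ eq with u ≟ u | u′ ≟ u′
  ... | yes _ | yes _ = refl
  ... | no ¬p | _     = contradiction refl ¬p
  ... | _     | no ¬p = contradiction refl ¬p
  same-eq u u′ lt' = ≡-trans (irrefl o u) (sym (irrefl o u′))
  same-eq u u′ gt  = ≡-trans (irrefl o u) (sym (irrefl o u′))

extend-here : ∀ {S n u v} {a : Fin n} {ρ : Env S n} (e : v ≡ u) → extend a ρ v (here e) ≡ a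
extend-here refl = refl

-- Evaluation inside a table

module Relativised (N top hues K : ℕ) where
  open Tables N top hues

  -- The signed depth, shifted by `suc top` to stay in `ℕ`. Depths never exceed `suc top`, so the
  -- subtraction does not truncate, and depth zero is the midpoint for both signs.
  height : Bool → ℕ → ℕ
  height true  r = suc top + r
  height false r = suc top ∸ r

  module _ {m : ℕ} (D : Table m) where

    tableKey : Fin m → Key
    tableKey p = toℕ (hue D p) , height (side D p) (suc (rank D p)) , toℕ p

    evalCmpR : Cmp → Fin m → Fin m → Bool
    evalCmpR eq  p q = ⌊ p ≟ q ⌋
    evalCmpR lt' p q = precedes (tableKey p) (tableKey q)
    evalCmpR gt  p q = precedes (tableKey q) (tableKey p)

    evalAtomR : ∀ {S} → Env S m → Atom N S → Bool
    evalAtomR σ (col ℓ v p)         = pred D ℓ (σ v p)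
    evalAtomR σ (edge w i j p q)    = adj D (σ (w , i) p) (σ (w , j) q)
    evalAtomR σ (cmp c w i j p q)   = evalCmpR c (σ (w , i) p) (σ (w , j) q)
    evalAtomR σ (cmpCh c w α i p q) = evalCmpR c (σ (w ∷ʳ α , 0) p) (σ (w , i) q)

    -- New clusters may only be rooted where the neighbourhood that the remaining quantifiers
    -- can explore is listed in the table.
    evalR : ∀ {S k} → Env S m → CFO N S k → Bool
    evalR σ (atom a)   = evalAtomR σ a
    evalR σ tt         = true
    evalR σ (neg φ)    = not (evalR σ φ)
    evalR σ (conj φ ψ) = evalR σ φ ∧ evalR σ ψ
    evalR σ (exRoot {k} φ) = exists λ p → ⌊ k * K + k ≤? rank D p ⌋ ∧ evalR (extend p σ) φ
    evalR σ (exChild {k = k} w α _ _ φ) = exists λ p → ⌊ k * K + k ≤? rank D p ⌋ ∧ evalR (extend p σ) φ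
    evalR σ (exNbr w i j p _ _ φ) = exists λ q → adj D q (σ (w , j) p) ∧ evalR (extend q σ) φ

-- The order defined by a good table, and the replies of the game

module Soundness (N d K : ℕ) where

  R top hues : ℕ
  R    = K * suc K
  top  = R + K * suc R
  hues = suc (ballSize d (R + R))

  open Tables N top hues public
  open Templates K R public
  open Relativised N top hues K public

  level-mono : ∀ {i j} → i ≤ j → level i ≤ level j
  level-mono i≤j = +-monoʳ-≤ R (*-monoˡ-≤ (suc R) i≤j)

  module Bounded {n : ℕ} {G : Graph N n} (deg : ∀ v → degree G v ≤ d) where

    -- The template that the `R`-ball of `a` realises in the final colouring. Two vertices of the
    -- ball are within `R + R`, which is why colours are kept apart up to that distance.
    module BallCode (colour : Fin n → Fin hues)
                    (colour-inj : ∀ {u v} → colour u ≡ colour v → Near G (R + R) u v → u ≡ v)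
                    (a : Fin n) where

      private
        vs = filter (near? {G = G} R a) (allFin n)
        vs! = filter⁺ (near? {G = G} R a) (allFin⁺ n)

      vertex : Fin (length vs) → Fin n
      vertex = lookup vs

      vertex-near : ∀ t → Near G R a (vertex t)
      vertex-near t = proj₂ (∈-filter⁻ (near? {G = G} R a) {xs = allFin n} (∈-lookup t))

      listed : ∀ {v} → Near G R a v → ∃ λ t → vertex t ≡ v
      listed {v} p = let v∈ = ∈-filter⁺ (near? {G = G} R a) (∈-allFin v) p
                     in index v∈ , sym (lookup-index v∈)

      root : Fin (length vs)
      root = proj₁ (listed stay)

      vertex-root : vertex root ≡ a
      vertex-root = proj₂ (listed stay)

      open MakeTable (λ s t → E G (vertex s) (vertex t)) (λ ℓ t → P G ℓ (vertex t))
        (λ t → bump {G = G} R a (vertex t))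
        (λ t → ≤-trans (descend≤ R 0 a (vertex t)) (m≤m+n R _))
        (λ t → colour (vertex t)) (λ _ → true) public

      code : Code
      code = length vs , table , root

      code∈ : code ∈ codes (ballSize d R)
      code∈ = ∈-codes (≤-trans
        (unique⊆⇒length≤ vs! λ v∈ → near⇒∈ball (proj₂ (∈-filter⁻ (near? {G = G} R a) {xs = allFin n} v∈)))
        (length-ball deg R a)) table root

      rank-root : rank table root ≡ R
      rank-root = ≡-trans (rank-table root)
        (descend-near R (subst (Near G 0 a) (sym vertex-root) stay))

      code-realised : Realises G code vertex
      code-realised = record
        { embeds  = record
          { injective = λ _ _ → unique⇒lookup-injective vs!
          ; adj-≡     = λ s t → sym (adj-table s t)
          ; pred-≡    = λ ℓ t → sym (pred-table ℓ t)
          ; closed    = λ t pos v tv →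
              -- Positive rank means distance strictly below `R`, so the neighbour `v` is still
              -- inside the ball.
              let (r , r<R , p) = descend-pos R 0 (subst (0 <_) (rank-table t) pos)
                  (s , s≡v)     = listed (near-mono r<R (near-snoc p tv))
              in s , s≡v , subst₂ (λ x y → x ≤ suc y) (sym (rank-table t)) (sym (rank-table s))
                   (descend-lipschitz R 0 (subst (λ w → E G (vertex t) w ≡ true) (sym s≡v) tv))
          }
        ; hue-inj = λ s t e → unique⇒lookup-injective vs!
            (colour-inj (subst₂ _≡_ (hue-table s) (hue-table t) e)
                        (near-trans (near-sym (vertex-near s)) (vertex-near t)))
        ; nearby  = λ t → subst (λ r → Near G R r (vertex t)) (sym vertex-root) (vertex-near t)
        }

    module Structure {m : ℕ} {D : Table m} {x : Fin m → Fin n}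
             (gd : Good G D x (codes (ballSize d R))) where

      open Good gd
      open Embedding embeds

      position : Fin n → Maybe (Fin m)
      position v with any? (λ p → x p ≟ v)
      ... | yes (p , _) = just p
      ... | no _        = nothing

      position-x : ∀ p → position (x p) ≡ just p
      position-x p with any? (λ q → x q ≟ x p)
      ... | yes (q , e) = cong just (injective q p e)
      ... | no none     = contradiction (p , refl) none

      position-just : ∀ {v p} → position v ≡ just p → x p ≡ v
      position-just {v} e with any? (λ q → x q ≟ v)
      position-just refl | yes (q , e) = e

      -- One more than the rank, so that vertices outside the table have depth zero.
      depth : Fin n → ℕ
      depth v = maybe (suc ∘ rank D) 0 (position v)

      depth-x : ∀ p → depth (x p) ≡ suc (rank D p)
      depth-x p = cong (maybe (suc ∘ rank D) 0) (position-x p)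

      depth-suc : ∀ {v r} → suc r ≤ depth v → ∃ λ p → x p ≡ v × r ≤ rank D p
      depth-suc {v} h with position v in e
      ... | just p = p , position-just e , s≤s⁻¹ h

      depth≤ : ∀ v → depth v ≤ suc top
      depth≤ v with position v
      ... | just p  = s≤s (rank≤top D p)
      ... | nothing = z≤n

      -- Depths zero and one are trivial. Above that the rank is positive, and `closed` lists the
      -- neighbour with rank at most one lower.
      depth-lipschitz : ∀ {u v} → E G u v ≡ true → depth u ≤ suc (depth v)
      depth-lipschitz {u} {v} uv with depth u in e
      ... | zero        = z≤n
      ... | suc zero    = s≤s z≤n
      ... | suc (suc r) with depth-suc {u} {suc r} (≤-reflexive (sym e))
      ... | p , refl , r< with closed p (≤-trans (s≤s z≤n) r<) v uv
      ... | q , refl , rr = s≤s (subst (suc r ≤_) (sym (depth-x q)) (≤-trans r< rr))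

      sign : Fin n → Bool
      sign v = maybe (side D) true (position v)

      sign-x : ∀ p → sign (x p) ≡ side D p
      sign-x p = cong (maybe (side D) true) (position-x p)

      -- Listed vertices are numbered by the table, so that comparing them needs no knowledge of the
      -- graph; all others come after the first `m` numbers.
      tie : Fin n → ℕ
      tie v = maybe toℕ (m + toℕ v) (position v)

      tie-x : ∀ p → tie (x p) ≡ toℕ p
      tie-x p = cong (maybe toℕ (m + toℕ (x p))) (position-x p)

      tie-injective : ∀ {u v} → tie u ≡ tie v → u ≡ v
      tie-injective {u} {v} e with position u in pu | position v in pv
      ... | just p  | just q  = ≡-trans (sym (position-just pu))
                                  (≡-trans (cong x (toℕ-injective e)) (position-just pv))
      ... | just p  | nothing = contradiction (toℕ<n p) (≤⇒≯ (subst (m ≤_) (sym e) (m≤m+n m _)))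
      ... | nothing | just q  = contradiction (toℕ<n q) (≤⇒≯ (subst (m ≤_) e (m≤m+n m _)))
      ... | nothing | nothing = toℕ-injective (+-cancelˡ-≡ m _ _ e)

      private
        partialColour : Colouring {G = G} (Fin hues)
        partialColour v = Maybe.map (hue D) (position v)

        partial-proper : Proper {G = G} (R + R) partialColour
        partial-proper {u} {v} eu ev p with position u in pu | position v in pv
        ... | just q | just q′ with position-just pu | position-just pv
        ... | refl | refl = cong x (proper q q′ p (just-injective (≡-trans eu (sym ev))))

        -- The hues of the table are fixed; the remaining vertices are coloured greedily, for which
        -- `hues` exceeds the bound on balls of radius `R + R`.
        extension = extendColouring {G = G} {r = R + R} (length-ball deg (R + R))
                      partialColour partial-proper

      colour : Fin n → Fin hues
      colour = proj₁ extension

      colour-x : ∀ p → colour (x p) ≡ hue D p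
      colour-x p = proj₁ (proj₂ extension) (cong (Maybe.map (hue D)) (position-x p))

      colour-inj : ∀ {u v} → colour u ≡ colour v → Near G (R + R) u v → u ≡ v
      colour-inj = proj₂ (proj₂ extension)

      key : Fin n → Key
      key v = toℕ (colour v) , height (sign v) (depth v) , tie v

      opaque
        order : LinOrder n
        order = keyOrder key tie-injective

        lt-order : ∀ u v → lt order u v ≡ precedes (key u) (key v)
        lt-order u v = refl

      key-x : ∀ p → key (x p) ≡ tableKey D p
      key-x p = cong₂ _,_ (cong toℕ (colour-x p))
        (cong₂ _,_ (cong₂ height (sign-x p) (depth-x p)) (tie-x p))

      lt-colour : ∀ {u v} → toℕ (colour u) < toℕ (colour v) → lt order u v ≡ true
      lt-colour h = ≡-trans (lt-order _ _) (lexStep-< h)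

      lt-height : ∀ {u v} → colour u ≡ colour v →
                  height (sign u) (depth u) < height (sign v) (depth v) → lt order u v ≡ true
      lt-height {u} {v} e h = ≡-trans (lt-order _ _) (≡-trans (lexStep-≡ (cong toℕ e)) (lexStep-< h))

      -- Of two vertices of the same colour, the deeper one decides the comparison by its sign.
      deeper-after : ∀ {u v} → colour u ≡ colour v → depth u < depth v → sign v ≡ true →
                     lt order u v ≡ true
      deeper-after {u} {v} e h sv = lt-height e below
        where
        below : height (sign u) (depth u) < height (sign v) (depth v)
        below rewrite sv with sign u
        ... | true  = +-monoʳ-< (suc top) h
        ... | false = ≤-<-trans (m∸n≤m (suc top) (depth u)) (m<m+n (suc top) (≤-<-trans z≤n h))

      deeper-before : ∀ {u v} → colour u ≡ colour v → depth u < depth v → sign v ≡ false →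
                      lt order v u ≡ true
      deeper-before {u} {v} e h sv = lt-height (sym e) above
        where
        above : height (sign v) (depth v) < height (sign u) (depth u)
        above rewrite sv with sign u
        ... | true  = <-≤-trans (∸-monoʳ-< (≤-<-trans z≤n h) (depth≤ v)) (m≤m+n (suc top) (depth u))
        ... | false = ∸-monoʳ-< h (depth≤ v)

      -- Opposite signs lie on different sides of the midpoint, whichever of the two vertices is
      -- deeper. This settles comparisons in which the depths are equal or unknown.
      opposite : ∀ {u v} → colour u ≡ colour v → 0 < depth v → sign u ≡ false → sign v ≡ true →
                 lt order u v ≡ true
      opposite {u} {v} e h su sv = lt-height e below
        where
        below : height (sign u) (depth u) < height (sign v) (depth v)
        below rewrite su | sv = ≤-<-trans (m∸n≤m (suc top) (depth u)) (m<m+n (suc top) h)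

      same-colours : ∀ {u v u′ v′} → colour u ≢ colour v → colour u ≡ colour u′ →
                     colour v ≡ colour v′ → SameCmp order u v u′ v′
      same-colours {u} {v} u≢v eu ev with <-cmp (toℕ (colour u)) (toℕ (colour v))
      ... | tri< h _ _ = same-lt order (lt-colour h)
                           (lt-colour (subst₂ (λ a b → toℕ a < toℕ b) eu ev h))
      ... | tri≈ _ h _ = contradiction (toℕ-injective h) u≢v
      ... | tri> _ _ h = same-gt order (lt-colour h)
                           (lt-colour (subst₂ (λ a b → toℕ a < toℕ b) ev eu h))

      -- Two listings of neighbourhoods with the same structure.  An entry of reach at least two
      -- has all its neighbours listed; an entry of reach zero is irrelevant to the game.
      record Match (θ : ℕ) : Set where
        field
          size     : ℕ
          left     : Fin size → Fin n
          right    : Fin size → Fin n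
          reach    : Fin size → ℕ
          E-≡      : ∀ s t → E G (left s) (left t) ≡ E G (right s) (right t)
          P-≡      : ∀ ℓ t → P G ℓ (left t) ≡ P G ℓ (right t)
          colour-≡ : ∀ t → colour (left t) ≡ colour (right t)
          distinct : ∀ s t → colour (left s) ≡ colour (left t) → s ≡ t
          closedˡ  : ∀ t {v} → 2 ≤ reach t → E G (left t) v ≡ true →
                     ∃ λ s → left s ≡ v × reach t ≤ suc (reach s)
          closedʳ  : ∀ t {v} → 2 ≤ reach t → E G (right t) v ≡ true →
                     ∃ λ s → right s ≡ v × reach t ≤ suc (reach s)
          flat     : ∀ t → left t ≡ right t ⊎ (depth (left t) ≤ θ × depth (right t) ≤ θ)

        Safe : Set
        Safe = ∀ t → reach t ≤ depth (right t)

        Pairs : ℕ → Fin n → Fin n → Set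
        Pairs j a a′ = ∃ λ t → j ≤ reach t × left t ≡ a × right t ≡ a′

        Agrees : ℕ → Fin n → Fin n → Set
        Agrees j a a′ = ∀ t → j ≤ reach t → SameCmp order a (left t) a′ (right t)

      open Match

      empty : ∀ {θ} → Match θ
      empty = record
        { size = 0 ; left = λ () ; right = λ () ; reach = λ () ; E-≡ = λ () ; P-≡ = λ _ ()
        ; colour-≡ = λ () ; distinct = λ () ; closedˡ = λ () ; closedʳ = λ () ; flat = λ () }

      swap : ∀ {θ} → Match θ → Match θ
      swap M = record
        { size = size M ; left = right M ; right = left M ; reach = reach M
        ; E-≡ = λ s t → sym (E-≡ M s t) ; P-≡ = λ ℓ t → sym (P-≡ M ℓ t)
        ; colour-≡ = λ t → sym (colour-≡ M t)
        ; distinct = λ s t e → distinct M s t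
            (≡-trans (colour-≡ M s) (≡-trans e (sym (colour-≡ M t))))
        ; closedˡ = closedʳ M ; closedʳ = closedˡ M
        ; flat = λ t → flat-swap (flat M t) }
        where
        flat-swap : ∀ {a b : Fin n} {θ} → a ≡ b ⊎ (depth a ≤ θ × depth b ≤ θ) →
                    b ≡ a ⊎ (depth b ≤ θ × depth a ≤ θ)
        flat-swap (inj₁ e)       = inj₁ (sym e)
        flat-swap (inj₂ (p , q)) = inj₂ (q , p)

      weaken : ∀ {θ θ′} → θ ≤ θ′ → Match θ → Match θ′
      weaken θ≤ M = record
        { size = size M ; left = left M ; right = right M ; reach = reach M
        ; E-≡ = E-≡ M ; P-≡ = P-≡ M ; colour-≡ = colour-≡ M ; distinct = distinct M
        ; closedˡ = closedˡ M ; closedʳ = closedʳ M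
        ; flat = λ t → flat-weaken (flat M t) }
        where
        flat-weaken : ∀ {a b : Fin n} → a ≡ b ⊎ (depth a ≤ _ × depth b ≤ _) →
                      a ≡ b ⊎ (depth a ≤ _ × depth b ≤ _)
        flat-weaken (inj₁ e)       = inj₁ e
        flat-weaken (inj₂ (p , q)) = inj₂ (≤-trans p θ≤ , ≤-trans q θ≤)

      -- Lowering each reach to the depth on the right makes a match safe.
      cut : ∀ {θ} → Match θ → Match θ
      cut M = record
        { size = size M ; left = left M ; right = right M
        ; reach = reach′
        ; E-≡ = E-≡ M ; P-≡ = P-≡ M ; colour-≡ = colour-≡ M ; distinct = distinct M
        ; closedˡ = λ t two tv →
            -- The edge is transferred to the right side, since that is where the cut measures
            -- depth.
            let (s , s≡ , r) = closedˡ M t (≤-trans two (m⊓n≤m _ _)) tv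
            in s , s≡ , lower t s r
                 (subst (_≡ true) (E-≡ M t s) (subst (λ w → E G (left M t) w ≡ true) (sym s≡) tv))
        ; closedʳ = λ t two tv →
            let (s , s≡ , r) = closedʳ M t (≤-trans two (m⊓n≤m _ _)) tv
            in s , s≡ , lower t s r (subst (λ w → E G (right M t) w ≡ true) (sym s≡) tv)
        ; flat = flat M }
        where
        reach′ : Fin (size M) → ℕ
        reach′ t = reach M t ⊓ depth (right M t)

        lower : ∀ t s → reach M t ≤ suc (reach M s) → E G (right M t) (right M s) ≡ true →
                reach′ t ≤ suc (reach′ s)
        lower t s r e = ⊓-mono-≤ r (depth-lipschitz e)

      cut-safe : ∀ {θ} (M : Match θ) → Safe (cut M)
      cut-safe M t = m⊓n≤n (reach M t) (depth (right M t))

      cut-pairs : ∀ {θ j a a′} {M : Match θ} → Pairs M j a a′ → j ≤ depth a′ → Pairs (cut M) j a a′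
      cut-pairs (t , r , l , refl) j≤ = t , ⊓-glb r j≤ , l , refl

      listed-agree : ∀ {θ} (M : Match θ) s t →
                     SameCmp order (left M s) (left M t) (right M s) (right M t)
      listed-agree M s t with s ≟ t
      ... | yes refl = same-eq order _ _
      ... | no s≢t   = same-colours (s≢t ∘ distinct M s t) (colour-≡ M s) (colour-≡ M t)

      -- Two occurrences of one template with the prescribed colours. Reach is counted like depth,
      -- one above the rank, so reach at least two means positive rank, where `closed` applies.
      matchCode : ∀ {θ} (q : Code) {y y′ : Fin (proj₁ q) → Fin n} →
                  Realises G q y → Realises G q y′ →
                  (∀ t → colour (y t) ≡ hue (proj₁ (proj₂ q)) t) →
                  (∀ t → colour (y′ t) ≡ hue (proj₁ (proj₂ q)) t) →
                  (∀ t → y t ≡ y′ t ⊎ (depth (y t) ≤ θ × depth (y′ t) ≤ θ)) → Match θ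
      matchCode (k , C , root) {y} {y′} ry ry′ cy cy′ fl = record
        { size = k ; left = y ; right = y′ ; reach = suc ∘ rank C
        ; E-≡ = λ s t → ≡-trans (adj-≡ ey s t) (sym (adj-≡ ey′ s t))
        ; P-≡ = λ ℓ t → ≡-trans (pred-≡ ey ℓ t) (sym (pred-≡ ey′ ℓ t))
        ; colour-≡ = λ t → ≡-trans (cy t) (sym (cy′ t))
        ; distinct = λ s t e → Realises.hue-inj ry s t (≡-trans (sym (cy s)) (≡-trans e (cy t)))
        ; closedˡ = λ t r tv → let (s , s≡ , p) = closed ey t (s≤s⁻¹ r) _ tv in s , s≡ , s≤s p
        ; closedʳ = λ t r tv → let (s , s≡ , p) = closed ey′ t (s≤s⁻¹ r) _ tv in s , s≡ , s≤s p
        ; flat = fl }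
        where
        open Embedding
        ey  = Realises.embeds ry
        ey′ = Realises.embeds ry′

      -- Here `i` rounds are over, `j` remain after this one, and `c` is the limit of the parent
      -- cluster. The field `inside` is conditional because the backward direction uses a swapped
      -- match, whose right side may leave the table.
      record Answer (i j c : ℕ) (L : Match (level i)) (a : Fin n) : Set where
        field
          reply  : Fin n
          match  : Match (level (suc i))
          pairs  : Pairs match (j * K + suc j) a reply
          agrees : Agrees L (suc c) a reply
          inside : Safe L → j * K + suc j ≤ depth reply

      -- The reply to a is its partner if a is listed nearby, a itself if it is deep, and otherwise
      -- a planted vertex with the same neighbourhood, whose sign puts it on the right side of
      -- the only relevant vertex of the same colour.
      module _ (i j c : ℕ) (i+j : i + suc j ≡ K) (j+c : j * K + suc j ≤ suc c)
               (L : Match (level i)) (a : Fin n) where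

        private
          -- Origin of `R`: the demand is `suc (j * suc K)`, and `j` is at most `K`.
          j≤R : j * K + suc j ≤ suc R
          j≤R = subst (_≤ suc R) (sym (+-suc (j * K) j)) (s≤s (≤-trans
            (≤-reflexive (≡-trans (+-comm (j * K) j) (sym (*-suc j K))))
            (*-monoˡ-≤ (suc K) (≤-trans (n≤1+n j) (subst (suc j ≤_) i+j (m≤n+m (suc j) i))))))

          i<K : i < K
          i<K = subst (suc i ≤_) (≡-trans (sym (+-suc i j)) i+j) (m≤m+n (suc i) j)

          j≤level : j * K + suc j ≤ suc (level i)
          j≤level = ≤-trans j≤R (s≤s (m≤m+n R _))

          level≤top : level i ≤ top
          level≤top = level-mono (<⇒≤ i<K)

          module B = BallCode colour colour-inj a

          B-colour : ∀ t → colour (B.vertex t) ≡ hue B.table t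
          B-colour t = sym (B.hue-table t)

          root-reach : j * K + suc j ≤ suc (rank B.table B.root)
          root-reach = ≤-trans j≤R (≤-reflexive (cong suc (sym B.rank-root)))

          -- Origin of the spacing of levels: `R + suc (level i)` is `level (suc i)` by definition.
          shallow-neighbour : ∀ {b v} → depth b ≤ suc (level i) → Near G R b v →
                              depth v ≤ level (suc i)
          shallow-neighbour b≤ p =
            ≤-trans (near-lipschitz {f = depth} depth-lipschitz (near-sym p)) (+-monoʳ-≤ R b≤)

        -- The new cluster inherits the match of its parent. The gap between the two limits
        -- guarantees the remaining reach.
        near-answer : ∀ t → suc c ≤ reach L t → left L t ≡ a → Answer i j c L a
        near-answer t r refl = record
          { reply  = right L t
          ; match  = weaken (level-mono (n≤1+n i)) L
          ; pairs  = t , ≤-trans j+c r , refl , refl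
          ; agrees = λ s _ → listed-agree L t s
          ; inside = λ safe → ≤-trans j+c (≤-trans r (safe t)) }

        deep-answer : suc (level i) ≤ depth a → Answer i j c L a
        deep-answer deep = record
          { reply  = a
          ; match  = matchCode B.code B.code-realised B.code-realised B-colour B-colour
                       λ _ → inj₁ refl
          ; pairs  = B.root , root-reach , B.vertex-root , B.vertex-root
          ; agrees = λ t _ → agree t (flat L t)
          ; inside = λ _ → ≤-trans j≤level deep }
          where
          agree : ∀ t → left L t ≡ right L t ⊎
                        (depth (left L t) ≤ level i × depth (right L t) ≤ level i) →
                  SameCmp order a (left L t) a (right L t)
          agree t (inj₁ e) c = cong (evalCmp order c a) e
          -- Both partners are shallower than `a`, so the sign of `a` decides both comparisons
          -- alike.
          agree t (inj₂ (p , q)) with colour a ≟ colour (left L t)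
          ... | no a≢l = same-colours a≢l refl (colour-≡ L t)
          ... | yes e with sign a in sa
          ... | true  = same-gt order
                          (deeper-after (sym e) (≤-<-trans p deep) sa)
                          (deeper-after (sym (≡-trans e (colour-≡ L t))) (≤-<-trans q deep) sa)
          ... | false = same-lt order
                          (deeper-before (sym e) (≤-<-trans p deep) sa)
                          (deeper-before (sym (≡-trans e (colour-≡ L t))) (≤-<-trans q deep) sa)

        module _ (far : ∀ t → suc c ≤ reach L t → left L t ≢ a)
                 (shallow : depth a ≤ level i) where

          GoodSign : Bool → Set
          GoodSign s = ∀ {a′} → colour a ≡ colour a′ → depth a′ ≡ suc (level i) → sign a′ ≡ s →
                       Agrees L (suc c) a a′

          -- Colours within a match are distinct, so `t` is the only entry coloured like `a`;
          -- comparisons with all others are settled by colour.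
          agree-at : ∀ {s} t →
            (∀ {a′} → colour a ≡ colour a′ → depth a′ ≡ suc (level i) → sign a′ ≡ s →
              colour a ≡ colour (left L t) → SameCmp order a (left L t) a′ (right L t)) →
            colour a ≡ colour (left L t) → GoodSign s
          agree-at t h et {a′} ea da sa u r with t ≟ u
          ... | yes refl = h ea da sa et
          ... | no t≢u   = same-colours (λ e → t≢u (distinct L t u (≡-trans (sym et) e)))
                             ea (colour-≡ L u)

          -- A deep entry has equal partners and decides by its own sign against the shallow `a`.
          -- The reply may be less deep or equally deep, so it gets the opposite sign and falls on
          -- the same side. If the entry is not deep, the reply will be deeper than its partner, and
          -- its sign copies the actual order of `a` and the entry.
          signFor : ∀ t → suc c ≤ reach L t → colour a ≡ colour (left L t) → ∃ GoodSign
          signFor t r et with suc (level i) ≤? depth (left L t)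
          ... | yes deep with flat L t
          ... | inj₂ (p , _) = contradiction deep (≤⇒≯ p)
          ... | inj₁ l≡r with sign (left L t) in sl
          ... | true = false , agree-at t (λ ea da sa e → same-lt order
                    (deeper-after e (≤-<-trans shallow deep) sl)
                    (subst (λ w → lt order _ w ≡ true) l≡r
                      (opposite (≡-trans (sym ea) e) (≤-trans (s≤s z≤n) deep) sa sl))) et
          ... | false = true , agree-at t (λ ea da sa e → same-gt order
                    (deeper-before e (≤-<-trans shallow deep) sl)
                    (subst (λ w → lt order w _ ≡ true) l≡r
                      (opposite (≡-trans (sym e) ea) (subst (0 <_) (sym da) (s≤s z≤n)) sl sa))) et
          signFor t r et | no ¬deep = bySign (lt order a (left L t)) refl
            where
            lower : depth (right L t) ≤ level i
            lower with flat L t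
            ... | inj₁ e       = subst (λ w → depth w ≤ level i) e (s≤s⁻¹ (≰⇒> ¬deep))
            ... | inj₂ (_ , q) = q
            below : ∀ {a′} → depth a′ ≡ suc (level i) → depth (right L t) < depth a′
            below da = subst (depth (right L t) <_) (sym da) (s≤s lower)
            bySign : ∀ b → lt order a (left L t) ≡ b → ∃ GoodSign
            bySign true a<l = false , agree-at t (λ ea da sa e → same-lt order a<l
              (deeper-before (≡-trans (sym (colour-≡ L t)) (≡-trans (sym e) ea)) (below da) sa)) et
            bySign false a≮l with total order a (left L t) (far t r ∘ sym)
            ... | inj₁ a<l = contradiction (≡-trans (sym a<l) a≮l) λ ()
            ... | inj₂ l<a = true , agree-at t (λ ea da sa e → same-gt order l<a
              (deeper-after (≡-trans (sym (colour-≡ L t)) (≡-trans (sym e) ea)) (below da) sa)) et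

          chooseSign : ∃ GoodSign
          chooseSign with any? (λ t → (suc c ≤? reach L t) ×-dec (colour a ≟ colour (left L t)))
          ... | yes (t , r , e) = signFor t r e
          ... | no none = true , λ ea _ _ t r →
                            same-colours (λ e → none (t , r , e)) ea (colour-≡ L t)

          not-rare : ¬ Rare G D x B.code
          -- The ball of `a` is itself an occurrence, and its root `a` is too shallow to have rank
          -- `top`.
          not-rare rare = rare (B.vertex , B.code-realised , λ (p , e , h) →
            <⇒≱ (s≤s (≤-trans level≤top h))
                (subst (_≤ level i)
                  (≡-trans (cong depth (≡-trans (sym B.vertex-root) (sym e))) (depth-x p)) shallow))

          plantedAnswer : ∃ (λ s → GoodSign s × ∃ (Planted G D x B.code (fromℕ< i<K) s)) →
                          Answer i j c L a
          plantedAnswer (s , goodSign , y , planted realised (p , xp , rk , sd) coloured) = record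
            { reply  = y B.root
            ; match  = matchCode B.code B.code-realised realised B-colour y-colour λ t →
                inj₂ ( shallow-neighbour (≤-trans shallow (n≤1+n _)) (B.vertex-near t)
                     , shallow-neighbour (≤-reflexive y-depth) (Realises.nearby realised t))
            ; pairs  = B.root , root-reach , B.vertex-root , refl
            ; agrees = goodSign
                (≡-trans (cong colour (sym B.vertex-root))
                         (≡-trans (B-colour B.root) (sym (y-colour B.root))))
                y-depth (≡-trans (cong sign (sym xp)) (≡-trans (sign-x p) sd))
            ; inside = λ _ → ≤-trans j≤level (≤-reflexive (sym y-depth)) }
            where
            y-depth : depth (y B.root) ≡ suc (level i)
            y-depth = ≡-trans (cong depth (sym xp)) (≡-trans (depth-x p)
              (cong suc (≡-trans rk (cong level (toℕ-fromℕ< i<K)))))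
            y-colour : ∀ t → colour (y t) ≡ hue B.table t
            y-colour t = let (q , xq , h) = coloured t
                         in ≡-trans (cong colour (sym xq)) (≡-trans (colour-x q) h)

          far-answer : Answer i j c L a
          far-answer with coded B.code B.code∈
          ... | inj₁ rare = contradiction rare not-rare
          ... | inj₂ plant = let (s , g) = chooseSign
                             in plantedAnswer (s , g , plant (fromℕ< i<K) s (∈-bools s))

        answer : Answer i j c L a
        answer with any? (λ t → (suc c ≤? reach L t) ×-dec (left L t ≟ a))
        ... | yes (t , r , e) = near-answer t r e
        ... | no none with suc (level i) ≤? depth a
        ... | yes deep = deep-answer deep
        ... | no ¬deep = far-answer (λ t r e → none (t , r , e)) (s≤s⁻¹ (≰⇒> ¬deep))

-- The game between the graph and the table

∧-true : ∀ {a b} → a ≡ true → b ≡ true → a ∧ b ≡ true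
∧-true refl refl = refl

∧-splits : ∀ {a b} → a ∧ b ≡ true → a ≡ true × b ≡ true
∧-splits {true} {true} _ = refl , refl

⌊⌋-true : {A : Set} {a? : Dec A} → A → ⌊ a? ⌋ ≡ true
⌊⌋-true {a? = yes _} a = refl
⌊⌋-true {a? = no ¬a} a = contradiction a ¬a

⌊⌋-holds : {A : Set} {a? : Dec A} → ⌊ a? ⌋ ≡ true → A
⌊⌋-holds {a? = yes a} _ = a

module Game (N d K : ℕ) {n : ℕ} {G : Graph N n} (deg : ∀ v → degree G v ≤ d) {m : ℕ}
            {D : Soundness.Table N d K m} {x : Fin m → Fin n}
            (gd : Soundness.Good N d K G D x (Soundness.codes N d K (ballSize d (Soundness.R N d K)))) where
  open Soundness N d K
  open Bounded {G = G} deg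
  open Structure gd
  open Match
  open Embedding (Good.embeds gd) using (injective; adj-≡; pred-≡)

  -- Each cluster w has a match and a limit: its members stay among the entries whose reach
  -- exceeds the limit, so these are the entries its child clusters are compared with.
  record Position (i j : ℕ) {S : List Var} (ρ ρ′ : Env S n) : Set where
    field
      local     : List ℕ → ℕ × Match (level i)
      limited   : ∀ w → j * K ≤ proj₁ (local w)
      safe      : ∀ w → Safe (proj₂ (local w))
      listed    : ∀ w l p → Pairs (proj₂ (local w)) (proj₁ (local w) + suc j)
                                  (ρ (w , l) p) (ρ′ (w , l) p)
      related   : ∀ w α p → Agrees (proj₂ (local w)) (suc (proj₁ (local w)))
                                   (ρ (w ∷ʳ α , 0) p) (ρ′ (w ∷ʳ α , 0) p)
      -- Validity of `S` is not recorded in the syntax, so it is carried along as an invariant.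
      has-root  : ∀ w l → (w , l) ∈ S → (w , 0) ∈ S
      has-above : ∀ w α → (w ∷ʳ α , 0) ∈ S → (w , 0) ∈ S

  open Position

  -- Words without a cluster hold the empty match. With all `K` rounds ahead, `K * K` is the least
  -- limit that `limited` permits.
  start : ∀ {ρ ρ′ : Env [] n} → Position 0 K ρ ρ′
  start = record
    { local = λ _ → K * K , empty ; limited = λ _ → ≤-refl ; safe = λ _ ()
    ; listed = λ _ _ () ; related = λ _ _ () ; has-root = λ _ _ () ; has-above = λ _ _ () }

  pairs-anti : ∀ {θ j k a a′} {M : Match θ} → j ≤ k → Pairs M k a a′ → Pairs M j a a′
  pairs-anti j≤k (t , r , e , e′) = t , ≤-trans j≤k r , e , e′

  newCluster : ∀ {i j S} {ρ ρ′ : Env S n} (pos : Position i (suc j) ρ ρ′) (u : List ℕ) →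
               (u , 0) ∉ S → ∀ {a a′} (M : Match (level (suc i))) → Safe M →
               Pairs M (j * K + suc j) a a′ →
               (∀ w α → w ∷ʳ α ≡ u → (w , 0) ∈ S ×
                  Agrees (proj₂ (local pos w)) (suc (proj₁ (local pos w))) a a′) →
               Position (suc i) j (extend {u = u , 0} a ρ) (extend a′ ρ′)
  newCluster {i} {j} {S} {ρ} {ρ′} pos u u∉ {a} {a′} M safeM pairsM parent = record
    { local     = local′
    ; limited   = limited′
    ; safe      = safe′
    ; listed    = listed′
    ; related   = related′
    ; has-root  = λ { w .0 (here refl) → here refl ; w l (there p) → there (has-root pos w l p) }
    ; has-above = λ { w α (here e)  → there (proj₁ (parent w α (cong proj₁ e)))
                    ; w α (there p) → there (has-above pos w α p) } }
    where
    old : List ℕ → ℕ × Match (level (suc i))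
    old w = proj₁ (local pos w) , weaken (level-mono (n≤1+n i)) (proj₂ (local pos w))

    local′ : List ℕ → ℕ × Match (level (suc i))
    local′ w with ≡-dec _≟ℕ_ w u
    ... | yes _ = j * K , M
    ... | no _  = old w

    local′-new : local′ u ≡ (j * K , M)
    local′-new with ≡-dec _≟ℕ_ u u
    ... | yes _ = refl
    ... | no ¬p = contradiction refl ¬p

    -- Only the entry of the new word `u` is overwritten, so the matches of existing clusters, and
    -- the comparisons made with them, survive.
    local′-old : ∀ {w} → (w , 0) ∈ S → local′ w ≡ old w
    local′-old {w} w∈ with ≡-dec _≟ℕ_ w u
    ... | yes refl = contradiction w∈ u∉
    ... | no _     = refl

    limited′ : ∀ w → j * K ≤ proj₁ (local′ w)
    limited′ w with ≡-dec _≟ℕ_ w u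
    ... | yes _ = ≤-refl
    ... | no _  = ≤-trans (m≤n+m (j * K) K) (limited pos w)

    safe′ : ∀ w → Safe (proj₂ (local′ w))
    safe′ w with ≡-dec _≟ℕ_ w u
    ... | yes _ = safeM
    ... | no _  = safe pos w

    PairsIn AgreesIn : ℕ × Match (level (suc i)) → Fin n → Fin n → Set
    PairsIn  (c , L) = Pairs L (c + suc j)
    AgreesIn (c , L) = Agrees L (suc c)

    listed′ : ∀ w l p → PairsIn (local′ w) (extend a ρ (w , l) p) (extend a′ ρ′ (w , l) p)
    listed′ w l (here refl) = subst (λ L → PairsIn L a a′) (sym local′-new) pairsM
    listed′ w l (there p)   = subst (λ L → PairsIn L (ρ (w , l) p) (ρ′ (w , l) p))
      (sym (local′-old (has-root pos w l p)))
      (pairs-anti {M = proj₂ (old w)} (+-monoʳ-≤ (proj₁ (old w)) (n≤1+n _)) (listed pos w l p))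

    related′ : ∀ w α p → AgreesIn (local′ w)
                 (extend a ρ (w ∷ʳ α , 0) p) (extend a′ ρ′ (w ∷ʳ α , 0) p)
    related′ w α (here e) =
      subst₂ (AgreesIn (local′ w)) (sym (extend-here e)) (sym (extend-here e))
        (subst (λ L → AgreesIn L a a′) (sym (local′-old (proj₁ above))) (proj₂ above))
      where above = parent w α (cong proj₁ e)
    related′ w α (there p) = subst
      (λ L → AgreesIn L (ρ (w ∷ʳ α , 0) p) (ρ′ (w ∷ʳ α , 0) p))
      (sym (local′-old (has-above pos w α p)))
      (related pos w α p)

  newMember : ∀ {i j S} {ρ ρ′ : Env S n} (pos : Position i (suc j) ρ ρ′) (w : List ℕ) (l l₀ : ℕ) →
              (w , l₀) ∈ S → (w , l) ∉ S →
              ∀ {a a′} → Pairs (proj₂ (local pos w)) (proj₁ (local pos w) + suc j) a a′ →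
              Position (suc i) j (extend {u = w , l} a ρ) (extend a′ ρ′)
  newMember {i} {j} {S} {ρ} {ρ′} pos w l l₀ w∈ w∉ {a} {a′} pairs = record
    { local     = λ v → proj₁ (local pos v) , weaken (level-mono (n≤1+n i)) (proj₂ (local pos v))
    ; limited   = λ v → ≤-trans (m≤n+m (j * K) K) (limited pos v)
    ; safe      = λ v → safe pos v
    ; listed    = λ { v .l (here refl) → pairs
                    ; v l′ (there p)   → pairs-anti {M = proj₂ (local pos v)}
                        (+-monoʳ-≤ (proj₁ (local pos v)) (n≤1+n _)) (listed pos v l′ p) }
    ; related   = λ { v α (here e)  → contradiction (cong proj₂ e) not-root
                    ; v α (there p) → related pos v α p }
    ; has-root  = λ { v .l (here refl) → there (has-root pos v l₀ w∈)
                    ; v l′ (there p)   → there (has-root pos v l′ p) }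
    ; has-above = λ { v α (here e)  → contradiction (cong proj₂ e) not-root
                    ; v α (there p) → there (has-above pos v α p) } }
    where
    -- The cluster already has its root, so the new variable is no root and no comparison with a
    -- parent cluster arises.
    not-root : 0 ≢ l
    not-root refl = w∉ (has-root pos w l₀ w∈)

  -- ρ and ρ′ are the two sides of the game; σ is ρ′ as seen in the table.
  Tracks : ∀ {S} → Env S m → Env S n → Set
  Tracks σ ρ′ = ∀ v p → ρ′ v p ≡ x (σ v p)

  tracks-extend : ∀ {S u} {σ : Env S m} {ρ′ : Env S n} {p a′} → Tracks σ ρ′ → a′ ≡ x p →
                  Tracks (extend {u = u} p σ) (extend a′ ρ′)
  tracks-extend tr e _ (here refl) = e
  tracks-extend tr e v (there q)   = tr v q

  evalCmp-table : ∀ c p q → evalCmp order c (x p) (x q) ≡ evalCmpR D c p q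
  evalCmp-table eq p q with x p ≟ x q | p ≟ q
  ... | yes _ | yes _    = refl
  ... | yes e | no p≢q   = contradiction (injective p q e) p≢q
  ... | no ¬e | yes refl = contradiction refl ¬e
  ... | no _  | no _     = refl
  evalCmp-table lt' p q = ≡-trans (lt-order (x p) (x q)) (cong₂ precedes (key-x p) (key-x q))
  evalCmp-table gt  p q = ≡-trans (lt-order (x q) (x p)) (cong₂ precedes (key-x q) (key-x p))

  evalCmp-tracks : ∀ c {a b a′ b′ p q} → SameCmp order a b a′ b′ → a′ ≡ x p → b′ ≡ x q →
                   evalCmp order c a b ≡ evalCmpR D c p q
  evalCmp-tracks c {p = p} {q} same refl refl = ≡-trans (same c) (evalCmp-table c p q)

  evalAtom-table : ∀ {i j S} {ρ ρ′ : Env S n} {σ : Env S m} → Position i j ρ ρ′ → Tracks σ ρ′ →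
                   (at : Atom N S) → evalAtom G order ρ at ≡ evalAtomR D σ at
  evalAtom-table {ρ = ρ} {ρ′} {σ} pos tr (col ℓ (w , l) p) with listed pos w l p
  ... | t , _ , e , e′ = ≡-trans (cong (P G ℓ) (sym e))
        (≡-trans (P-≡ (proj₂ (local pos w)) ℓ t)
          (≡-trans (cong (P G ℓ) (≡-trans e′ (tr _ p))) (pred-≡ ℓ _)))
  evalAtom-table {ρ = ρ} {ρ′} {σ} pos tr (edge w l l₁ p q) with listed pos w l p | listed pos w l₁ q
  ... | s , _ , e , e′ | t , _ , f , f′ = ≡-trans (cong₂ (E G) (sym e) (sym f))
        (≡-trans (E-≡ (proj₂ (local pos w)) s t)
          (≡-trans (cong₂ (E G) (≡-trans e′ (tr _ p)) (≡-trans f′ (tr _ q))) (adj-≡ _ _)))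
  evalAtom-table {ρ = ρ} {ρ′} {σ} pos tr (cmp c w l l₁ p q) with listed pos w l p | listed pos w l₁ q
  ... | s , _ , e , e′ | t , _ , f , f′ = evalCmp-tracks c
        (subst₂ (λ a a′ → SameCmp order a (ρ (w , l₁) q) a′ (ρ′ (w , l₁) q)) e e′
          (subst₂ (λ b b′ → SameCmp order (left L s) b (right L s) b′) f f′ (listed-agree L s t)))
        (tr _ p) (tr _ q)
    where L = proj₂ (local pos w)
  evalAtom-table {ρ = ρ} {ρ′} {σ} pos tr (cmpCh c w α l p q) with listed pos w l q
  ... | t , r , f , f′ = evalCmp-tracks c
        (subst₂ (λ b b′ → SameCmp order (ρ (w ∷ʳ α , 0) p) b (ρ′ (w ∷ʳ α , 0) p) b′) f f′
          (related pos w α p t (≤-trans (m<m+n (proj₁ (local pos w)) (s≤s z≤n)) r)))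
        (tr _ p) (tr _ q)

  -- One round releases `K` units of the limit, and the new cluster spends at most `suc j` of them,
  -- one per vertex on a path from its root.
  limit-ok : ∀ i j {c} → i + suc j ≡ K → suc j * K ≤ c → j * K + suc j ≤ suc c
  limit-ok i j {c} i+j h = subst (_≤ suc c) (sym (+-suc (j * K) j)) (s≤s (≤-trans
    (≤-trans (+-monoʳ-≤ (j * K) (≤-trans (n≤1+n j) (subst (suc j ≤_) i+j (m≤n+m (suc j) i))))
             (≤-reflexive (+-comm (j * K) K))) h))

  rooted : ∀ j {a′} → j * K + suc j ≤ depth a′ → ∃ λ p → x p ≡ a′ × j * K + j ≤ rank D p
  rooted j {a′} h = depth-suc (subst (_≤ depth a′) (+-suc (j * K) j) h)

  unrooted : ∀ j {p} → j * K + j ≤ rank D p → j * K + suc j ≤ depth (x p)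
  unrooted j {p} h = subst₂ _≤_ (sym (+-suc (j * K) j)) (sym (depth-x p)) (s≤s h)

  Parent : ∀ {i j S} {ρ ρ′ : Env S n} → Position i j ρ ρ′ → List ℕ → List ℕ → Set
  Parent {S = S} pos u w = ∀ w′ α → w′ ∷ʳ α ≡ u → w′ ≡ w × (w , 0) ∈ S

  module _ {i j S} {ρ ρ′ : Env S n} (i+j : i + suc j ≡ K) (pos : Position i (suc j) ρ ρ′)
           (u w : List ℕ) (u∉ : (u , 0) ∉ S) (parent : Parent pos u w) where

    private
      c = proj₁ (local pos w)
      L = proj₂ (local pos w)
      c-ok = limit-ok i j i+j (limited pos w)

    clusterForth : ∀ a → ∃ λ p → j * K + j ≤ rank D p ×
                   Position (suc i) j (extend {u = u , 0} a ρ) (extend (x p) ρ′)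
    clusterForth a with answer i j c i+j c-ok L a
    ... | A with rooted j (Answer.inside A (safe pos w))
    ... | p , xp , h = p , h , subst (λ b → Position (suc i) j (extend a ρ) (extend b ρ′)) (sym xp)
        (newCluster pos u u∉ (cut M) (cut-safe M)
          (cut-pairs {M = M} (Answer.pairs A) (Answer.inside A (safe pos w)))
          λ w′ α e → let (w′≡w , w∈) = parent w′ α e in
            subst (λ v → (v , 0) ∈ S × Agrees (proj₂ (local pos v)) (suc (proj₁ (local pos v))) _ _)
                  (sym w′≡w) (w∈ , Answer.agrees A))
      where M = Answer.match A

    -- The reply is sought for the swapped match. Its depth is not controlled, but safety concerns
    -- only the table side, where the rank of `p` is given.
    clusterBack : ∀ p → j * K + j ≤ rank D p → ∃ λ a →
                  Position (suc i) j (extend {u = u , 0} a ρ) (extend (x p) ρ′)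
    clusterBack p h with answer i j c i+j c-ok (swap L) (x p)
    ... | A = Answer.reply A , newCluster pos u u∉ (cut M) (cut-safe M)
          (cut-pairs {M = M} (let (t , r , e , e′) = Answer.pairs A in t , r , e′ , e) (unrooted j h))
          λ w′ α e → let (w′≡w , w∈) = parent w′ α e in
            subst (λ v → (v , 0) ∈ S × Agrees (proj₂ (local pos v)) (suc (proj₁ (local pos v))) _ _)
                  (sym w′≡w) (w∈ , λ t r o → sym (Answer.agrees A t r o))
      where M = swap (Answer.match A)

  evalCFO-table : ∀ {i j S} (φ : CFO N S j) → i + j ≡ K → {ρ ρ′ : Env S n} {σ : Env S m} →
                  Position i j ρ ρ′ → Tracks σ ρ′ → evalCFO G order ρ φ ≡ evalR D σ φ
  evalCFO-table (atom at)  i+j pos tr = evalAtom-table pos tr at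
  evalCFO-table tt         i+j pos tr = refl
  evalCFO-table (neg φ)    i+j pos tr = cong not (evalCFO-table φ i+j pos tr)
  evalCFO-table (conj φ ψ) i+j pos tr =
    cong₂ _∧_ (evalCFO-table φ i+j pos tr) (evalCFO-table ψ i+j pos tr)
  evalCFO-table {i} (exRoot {j} φ) i+j {ρ} {ρ′} {σ} pos tr = exists-ext
    (λ a h → let (p , r , pos′) = clusterForth i+j pos [] [] (λ ()) orphan a in
      p , ∧-true (⌊⌋-true r) (≡-trans (sym (rec pos′)) h))
    (λ p h → let (r , h′) = ∧-splits h
                 (a , pos′) = clusterBack i+j pos [] [] (λ ()) orphan p (⌊⌋-holds r) in
      a , ≡-trans (rec pos′) h′)
    where
    -- The first cluster has no parent. The empty word is passed as a placeholder, and nothing is to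
    -- be compared with it.
    orphan : Parent pos [] []
    orphan []       α ()
    orphan (_ ∷ _) α ()
    rec : ∀ {a p} → Position (suc i) j (extend a ρ) (extend (x p) ρ′) →
          evalCFO G order (extend a ρ) φ ≡ evalR D (extend p σ) φ
    rec pos′ = evalCFO-table φ (≡-trans (sym (+-suc i j)) i+j) pos′ (tracks-extend tr refl)
  evalCFO-table {i} (exChild {k = j} w α w∈ u∉ φ) i+j {ρ} {ρ′} {σ} pos tr = exists-ext
    (λ a h → let (p , r , pos′) = clusterForth i+j pos (w ∷ʳ α) w u∉ parent a in
      p , ∧-true (⌊⌋-true r) (≡-trans (sym (rec pos′)) h))
    (λ p h → let (r , h′) = ∧-splits h
                 (a , pos′) = clusterBack i+j pos (w ∷ʳ α) w u∉ parent p (⌊⌋-holds r) in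
      a , ≡-trans (rec pos′) h′)
    where
    parent : Parent pos (w ∷ʳ α) w
    parent w′ α′ e = ∷ʳ-injectiveˡ w′ w e , w∈
    rec : ∀ {a p} → Position (suc i) j (extend a ρ) (extend (x p) ρ′) →
          evalCFO G order (extend a ρ) φ ≡ evalR D (extend p σ) φ
    rec pos′ = evalCFO-table φ (≡-trans (sym (+-suc i j)) i+j) pos′ (tracks-extend tr refl)
  evalCFO-table {i} (exNbr {k = j} w l l₀ w∈ _ w∉ φ) i+j {ρ} {ρ′} {σ} pos tr
    with listed pos w l₀ w∈
  ... | t , r , e , e′ = exists-ext
    (λ a h → let (ea , h′) = ∧-splits h
                 (s , s≡ , rs) = closedˡ L t two
                   (subst (λ v → E G v a ≡ true) (sym e) (≡-trans (E-sym G _ a) ea))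
                 reach-s = enough s rs
                 -- Safety turns positive reach into positive depth, so the partner lies in the
                 -- table.
                 (p , xp , _) = depth-suc {right L s} {0}
                   (≤-trans (≤-trans (s≤s z≤n) (m≤n+m (suc j) c)) (≤-trans reach-s (safe pos w s)))
             in p , ∧-true
                  (≡-trans (sym (adj-≡ p (σ (w , l₀) w∈)))
                    (≡-trans (cong₂ (E G) xp (sym (≡-trans e′ (tr _ w∈))))
                      (≡-trans (sym (E-≡ L s t))
                        (≡-trans (cong₂ (E G) s≡ e) ea))))
                  (≡-trans (sym (rec (newMember pos w l l₀ w∈ w∉ (s , reach-s , s≡ , sym xp)))) h′))
    (λ p h → let (ep , h′) = ∧-splits h
                 edge′ = ≡-trans (cong (E G (x p)) (≡-trans e′ (tr _ w∈)))
                           (≡-trans (adj-≡ p (σ (w , l₀) w∈)) ep)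
                 (s , s≡ , rs) = closedʳ L t two (≡-trans (E-sym G _ (x p)) edge′)
             in left L s , ∧-true
                  (≡-trans (cong (E G (left L s)) (sym e))
                    (≡-trans (E-≡ L s t) (≡-trans (cong (λ v → E G v (right L t)) s≡) edge′)))
                  (≡-trans (rec (newMember pos w l l₀ w∈ w∉ (s , enough s rs , refl , s≡))) h′))
    where
    c = proj₁ (local pos w)
    L = proj₂ (local pos w)
    -- Members have reach at least `c + suc (suc j)`. This lists all their neighbours, and losing
    -- one along the edge leaves what is required with `j` rounds to go.
    two : 2 ≤ reach L t
    two = ≤-trans (≤-trans (s≤s (s≤s z≤n)) (m≤n+m (suc (suc j)) c)) r
    enough : ∀ s → reach L t ≤ suc (reach L s) → c + suc j ≤ reach L s
    enough s h = s≤s⁻¹ (≤-trans (subst (_≤ reach L t) (+-suc c (suc j)) r) h)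
    rec : ∀ {a p} → Position (suc i) j (extend a ρ) (extend (x p) ρ′) →
          evalCFO G order (extend a ρ) φ ≡ evalR D (extend p σ) φ
    rec pos′ = evalCFO-table φ (≡-trans (sym (+-suc i j)) i+j) pos′ (tracks-extend tr refl)

  sound : (φ : CFO N [] K) → evalCFO G order emptyEnv φ ≡ evalR D emptyEnv φ
  sound φ = evalCFO-table φ refl {ρ′ = emptyEnv} start λ v ()

-- grown B β f s bounds the core obtained from s vertices in f rounds, each of which adds at most
-- B centres and then replaces the centres by balls of size β.
grown : ℕ → ℕ → ℕ → ℕ → ℕ
grown B β zero    s = s
grown B β (suc f) s = grown B β f (s + (B + s) * β)

s≤grown : ∀ B β f s → s ≤ grown B β f s
s≤grown B β zero    s = ≤-refl
s≤grown B β (suc f) s = ≤-trans (m≤m+n s _) (s≤grown B β f _)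

grown-mono : ∀ B β f {s t} → s ≤ t → grown B β f s ≤ grown B β f t
grown-mono B β zero    s≤t = s≤t
grown-mono B β (suc f) s≤t =
  grown-mono B β f (+-mono-≤ s≤t (*-monoˡ-≤ β (+-monoʳ-≤ B s≤t)))

-- Separating rare templates from frequent ones

module Covering {N n : ℕ} (G : Graph N n) (Δ : ℕ) {Q : Set} (A : Q → Fin n → Set)
                (A? : ∀ q v → Dec (A q v)) where

  Covers : Q → List (Fin n) → Set
  Covers q X = ∀ v → A q v → Any (λ u → Near G Δ u v) X

  covers? : ∀ q X → Dec (Covers q X)
  covers? q X = all? λ v → A? q v →-dec Any.any? (λ u → near? Δ u v) X

  -- The added vertices are arbitrary. Hence failure means that, whichever `b` vertices are added to
  -- `X`, some vertex satisfying `A q` remains far from all of them and from `X`.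
  Coverable : ℕ → Q → List (Fin n) → Set
  Coverable zero    q X = Covers q X
  Coverable (suc b) q X = Covers q X ⊎ ∃ λ v → Coverable b q (v ∷ X)

  opaque
    coverable? : ∀ b q X → Dec (Coverable b q X)
    coverable? zero    q X = covers? q X
    coverable? (suc b) q X = covers? q X ⊎-dec any? λ v → coverable? b q (v ∷ X)

  coverable-suc : ∀ b {q X} → Coverable b q X → Coverable (suc b) q X
  coverable-suc zero    c              = inj₁ c
  coverable-suc (suc b) (inj₁ c)       = inj₁ c
  coverable-suc (suc b) (inj₂ (v , c)) = inj₂ (v , coverable-suc b c)

  cover : ∀ b {q X} → Coverable b q X → ∃ λ Y → length Y ≤ b + length X × Covers q Y
  cover zero    {X = X} c        = X , ≤-refl , c
  cover (suc b) {X = X} (inj₁ c) = X , m≤n+m _ _ , c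
  cover (suc b) {X = X} (inj₂ (v , c)) =
    let (Y , small , c′) = cover b c in Y , ≤-trans small (≤-reflexive (+-suc b _)) , c′

  uncovered : ∀ {q X} → ¬ Covers q X → ∃ λ v → A q v × ∀ {u} → u ∈ X → ¬ Near G Δ u v
  uncovered {q} {X} ¬c with ¬∀⟶∃¬ n _ (λ v → A? q v →-dec Any.any? (λ u → near? Δ u v) X) ¬c
  ... | v , ¬imp with A? q v
  ... | yes a = v , a , λ u∈ p → ¬imp λ _ → lose u∈ p
  ... | no ¬a = contradiction (λ a → contradiction a ¬a) ¬imp

  module _ {d : ℕ} (deg : ∀ v → degree G v ≤ d) (B : ℕ) where

    opaque
      -- A coverable template is absorbed: all its occurrences enter `X` with the balls of its
      -- cover. This may make other templates coverable, so the test is repeated; each repetition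
      -- removes a template, which bounds their number.
      core : ∀ f (qs : List Q) → length qs ≤ f → (X : List (Fin n)) →
             ∃ λ Y → (∀ {u} → u ∈ X → u ∈ Y) × length Y ≤ grown B (ballSize d Δ) f (length X) ×
                     (∀ {q} → q ∈ qs → (∀ v → A q v → v ∈ Y) ⊎ ¬ Coverable B q Y)
      core f qs qs≤ X with Any.any? (λ q → coverable? B q X) qs
      ... | no none = X , (λ u∈ → u∈) , s≤grown B _ f _ , λ q∈ → inj₂ λ c → none (lose q∈ c)
      core zero [] _ X | yes ()
      core (suc f) qs qs≤ X | yes some with find some
      ... | q , q∈ , c with ∈-∃++ q∈ | cover B c
      ... | as , bs , refl | Y , small , covers =
        let (Z , sub , Z≤ , coded) = core f (as ++ bs) shorter X′
        in Z , (λ u∈ → sub (∈-++⁺ˡ u∈)) ,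
           ≤-trans Z≤ (grown-mono B _ f X′≤) ,
           λ q∈ → handle sub coded (∈-++⁻ as q∈)
        where
        X′ : List (Fin n)
        X′ = X ++ concatMap (ball {G = G} Δ) Y

        X′≤ : length X′ ≤ length X + (B + length X) * ballSize d Δ
        X′≤ = ≤-trans (≤-reflexive (length-++ X)) (+-monoʳ-≤ (length X)
          (≤-trans (length-concatMap≤ (ball Δ) (length-ball deg Δ) Y) (*-monoˡ-≤ _ small)))

        shorter : length (as ++ bs) ≤ f
        shorter = s≤s⁻¹ (≤-trans (≤-reflexive (≡-trans (cong suc (length-++ as))
          (≡-trans (sym (+-suc _ _)) (sym (length-++ as))))) qs≤)

        handle : ∀ {Z} → (∀ {u} → u ∈ X′ → u ∈ Z) →
                 (∀ {q} → q ∈ as ++ bs → (∀ v → A q v → v ∈ Z) ⊎ ¬ Coverable B q Z) →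
                 ∀ {r} → r ∈ as ⊎ r ∈ q ∷ bs → (∀ v → A r v → v ∈ Z) ⊎ ¬ Coverable B r Z
        handle sub coded (inj₁ r∈)         = coded (∈-++⁺ˡ r∈)
        handle sub coded (inj₂ (there r∈)) = coded (∈-++⁺ʳ as r∈)
        handle sub coded (inj₂ (here refl)) = inj₁ λ v a →
          sub (∈-++⁺ʳ X (∈-concatMap⁺ (ball Δ) (Any.map near⇒∈ball (covers v a))))

-- Construction of a good table

module _ {N n : ℕ} {G : Graph N n} where

  deepest : List (ℕ × Fin n) → Fin n → ℕ
  deepest []             v = 0
  deepest ((h , u) ∷ ss) v = bump {G = G} h u v ⊔ deepest ss v

  deepest-lipschitz : ∀ ss {u v} → E G u v ≡ true → deepest ss u ≤ suc (deepest ss v)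
  deepest-lipschitz []             e = z≤n
  deepest-lipschitz ((h , w) ∷ ss) e = ⊔-mono-≤ (descend-lipschitz h 0 e) (deepest-lipschitz ss e)

  bump≤deepest : ∀ {ss h u} v → (h , u) ∈ ss → bump {G = G} h u v ≤ deepest ss v
  bump≤deepest v (here refl)       = m≤m⊔n _ _
  bump≤deepest v (there {x = s} i) = ≤-trans (bump≤deepest v i) (m≤n⊔m (bump (proj₁ s) (proj₂ s) v) _)

  deepest≤ : ∀ {ss v k} → (∀ {h u} → (h , u) ∈ ss → bump {G = G} h u v ≤ k) → deepest ss v ≤ k
  deepest≤ {[]}     b = z≤n
  deepest≤ {_ ∷ ss} b = ⊔-lub (b (here refl)) (deepest≤ {ss} (b ∘ there))

  deepest-pos : ∀ ss {v} → 0 < deepest ss v → ∃ λ s → s ∈ ss × Near G (proj₁ s) (proj₂ s) v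
  deepest-pos ((h , u) ∷ ss) {v} pos with bump {G = G} h u v in e
  ... | suc _ = (h , u) , here refl , bump-pos (subst (0 <_) (sym e) (s≤s z≤n))
  ... | zero  = let (s , s∈ , p) = deepest-pos ss pos in s , there s∈ , p

module Completeness (N d K : ℕ) where
  open Soundness N d K

  templates : List Code
  templates = codes (ballSize d R)

  Slot : Set
  Slot = Code × Fin K × Bool

  opaque
    slots : List Slot
    slots = cartesianProduct templates (cartesianProduct (allFin K) bools)

    ∈-slots : ∀ {q i s} → q ∈ templates → s ∈ bools → (q , i , s) ∈ slots
    ∈-slots {i = i} q∈ s∈ = ∈-cartesianProduct⁺ q∈ (∈-cartesianProduct⁺ (∈-allFin i) s∈)

  -- Vertices further apart than this have disjoint colouring constraints and depth profiles.
  opaque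
    Δ : ℕ
    Δ = suc top + (R + (R + R) + R)

    top≤Δ : suc top ≤ Δ
    top≤Δ = m≤m+n (suc top) _

    4R≤Δ : R + (R + R) + R ≤ Δ
    4R≤Δ = m≤n+m _ (suc top)

  tableSize : ℕ
  tableSize = (grown (length slots) (ballSize d Δ) (length templates) 0 + length slots) *
              ballSize d (suc top)

  module _ {n : ℕ} {G : Graph N n} (deg : ∀ v → degree G v ≤ d) where

    RealisedAt : Code → Fin n → Set
    RealisedAt q v = ∃ λ y → Realises G q y × y (proj₂ (proj₂ q)) ≡ v

    open Covering G Δ RealisedAt (realisedAt? G)

    record Chosen : Set where
      field
        slot     : Slot
        vertex   : Fin (proj₁ (proj₁ slot)) → Fin n
        realised : Realises G (proj₁ slot) vertex

      centre : Fin n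
      centre = vertex (proj₂ (proj₂ (proj₁ slot)))

      stage : ℕ
      stage = suc (level (toℕ (proj₁ (proj₂ slot))))

    open Chosen

    template : Chosen → Code
    template c = proj₁ (slot c)

    Far : Chosen → Chosen → Set
    Far c c′ = ¬ Near G Δ (centre c) (centre c′)

    opaque
      -- Each chosen centre joins the set to be avoided and uses up one unit of the covering bound,
      -- so `length ss` units last for all slots.
      choose : ∀ (ss : List Slot) (Y : List (Fin n)) →
               Σ (List Chosen) λ cs → length cs ≤ length ss ×
                 (∀ {c u} → c ∈ cs → u ∈ Y → ¬ Near G Δ u (centre c)) × AllPairs Far cs ×
                 (∀ {s} → s ∈ ss → ¬ Coverable (length ss) (proj₁ s) Y →
                   ∃ λ c → c ∈ cs × slot c ≡ s)
      choose []       Y = [] , z≤n , (λ ()) , [] , λ ()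
      choose (s ∷ ss) Y with coverable? (suc (length ss)) (proj₁ s) Y
      -- Nothing is promised for a coverable template, so its slot is skipped.
      ... | yes cov = let (cs , short , far , pairs , all) = choose ss Y in
        cs , m≤n⇒m≤1+n short , far , pairs ,
        λ { (here refl) ¬cov → contradiction cov ¬cov
          ; (there s∈)  ¬cov → all s∈ (¬cov ∘ coverable-suc (length ss)) }
      ... | no ¬cov with uncovered (¬cov ∘ inj₁)
      ... | v , (y , r , refl) , v-far =
        let (cs , short , far , pairs , all) = choose ss (v ∷ Y) in
        c ∷ cs , s≤s short ,
        (λ { (here refl) u∈ → v-far u∈ ; (there c∈) u∈ → far c∈ (there u∈) }) ,
        All-tabulate (λ c∈ → far c∈ (here refl)) ∷ pairs ,
        λ { (here refl) _     → c , here refl , refl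
          ; (there s∈)  ¬cov′ → let (c′ , c′∈ , e) = all s∈ (λ cov → ¬cov′ (inj₂ (v , cov)))
                                in c′ , there c′∈ , e }
        where
        c : Chosen
        c = record { slot = s ; vertex = y ; realised = r }

    module Assignment
      (X : List (Fin n)) (chosen : List Chosen)
      (X-far : ∀ {c u} → c ∈ chosen → u ∈ X → ¬ Near G Δ u (centre c))
      (fars : AllPairs Far chosen) where

      equal-or-far : ∀ {c c′} → c ∈ chosen → c′ ∈ chosen → Near G Δ (centre c) (centre c′) → c ≡ c′
      equal-or-far = go fars
        where
        go : ∀ {cs c c′} → AllPairs Far cs → c ∈ cs → c′ ∈ cs → Near G Δ (centre c) (centre c′) → c ≡ c′
        go (far ∷ _)  (here refl) (here refl) _ = refl
        go (far ∷ _)  (here refl) (there c′∈) p = contradiction p (All-lookup far c′∈)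
        go (far ∷ _)  (there c∈)  (here refl) p = contradiction (near-sym p) (All-lookup far c∈)
        go (_ ∷ fars) (there c∈)  (there c′∈) p = go fars c∈ c′∈ p

      stage≤ : ∀ c → stage c ≤ suc top
      stage≤ c = s≤s (level-mono (<⇒≤ (toℕ<n (proj₁ (proj₂ (slot c))))))

      sources : List (ℕ × Fin n)
      sources = map (suc top ,_) X ++ map (λ c → stage c , centre c) chosen

      source-cases : ∀ {h u} → (h , u) ∈ sources →
                     (h ≡ suc top × u ∈ X) ⊎ ∃ λ c → c ∈ chosen × h ≡ stage c × u ≡ centre c
      source-cases s∈ with ∈-++⁻ (map (suc top ,_) X) s∈
      ... | inj₁ p with ∈-map⁻ (suc top ,_) p
      ... | _ , u∈ , refl = inj₁ (refl , u∈)
      source-cases s∈ | inj₂ p with ∈-map⁻ (λ c → stage c , centre c) p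
      ... | c , c∈ , refl = inj₂ (c , c∈ , refl , refl)

      source≤ : ∀ {h u} → (h , u) ∈ sources → h ≤ suc top
      source≤ s∈ with source-cases s∈
      ... | inj₁ (refl , _)         = ≤-refl
      ... | inj₂ (c , _ , refl , _) = stage≤ c

      depth : Fin n → ℕ
      depth = deepest {G = G} sources

      depth≤ : ∀ v → depth v ≤ suc top
      depth≤ v = deepest≤ {G = G} {sources} λ {h} {u} s∈ → ≤-trans (descend≤ h 0 u v) (source≤ s∈)

      source-depth : ∀ {h u} → (h , u) ∈ sources → h ≤ depth u
      source-depth {h} {u} s∈ =
        ≤-trans (≤-reflexive (sym (descend-near {G = G} h stay))) (bump≤deepest {G = G} u s∈)

      depth-X : ∀ {u} → u ∈ X → depth u ≡ suc top
      depth-X {u} u∈ = ≤-antisym (depth≤ u) (source-depth (∈-++⁺ˡ (∈-map⁺ (suc top ,_) u∈)))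

      bump-far : ∀ {h u v} → h ≤ suc top → ¬ Near G Δ u v → bump {G = G} h u v ≡ 0
      bump-far {h} {u} {v} h≤ ¬p with bump {G = G} h u v in e
      ... | zero  = refl
      ... | suc _ = contradiction
        (near-mono (≤-trans h≤ top≤Δ) (bump-pos (subst (0 <_) (sym e) (s≤s z≤n)))) ¬p

      -- Every other source is further away than `Δ`, beyond the range of any bump, so only the bump
      -- of `c` itself counts.
      depth-centre : ∀ {c} → c ∈ chosen → depth (centre c) ≡ stage c
      depth-centre {c} c∈ = ≤-antisym
        (deepest≤ {G = G} {sources} upper)
        (source-depth (∈-++⁺ʳ (map (suc top ,_) X) (∈-map⁺ (λ c → stage c , centre c) c∈)))
        where
        upper : ∀ {h u} → (h , u) ∈ sources → bump {G = G} h u (centre c) ≤ stage c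
        upper {h} {u} s∈ with near? {G = G} Δ u (centre c)
        ... | no ¬p = subst (_≤ stage c) (sym (bump-far (source≤ s∈) ¬p)) z≤n
        ... | yes p with source-cases s∈
        ... | inj₁ (_ , u∈) = contradiction p (X-far c∈ u∈)
        ... | inj₂ (c′ , c′∈ , refl , refl) with equal-or-far c′∈ c∈ p
        ... | refl = descend≤ (stage c) 0 (centre c) (centre c)

      sign : Fin n → Bool
      sign v with Any.any? (λ c → centre c ≟ v) chosen
      ... | yes some = proj₂ (proj₂ (slot (proj₁ (find some))))
      ... | no _     = true

      sign-centre : ∀ {c} → c ∈ chosen → sign (centre c) ≡ proj₂ (proj₂ (slot c))
      sign-centre {c} c∈ with Any.any? (λ c′ → centre c′ ≟ centre c) chosen
      ... | no none  = contradiction (lose c∈ refl) none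
      ... | yes some with find some
      ... | c′ , c′∈ , e = cong (proj₂ ∘ proj₂ ∘ slot)
        (equal-or-far c′∈ c∈ (subst (Near G Δ (centre c′)) e stay))

      Covered : Fin n → Chosen → Set
      Covered v c = ∃ λ t → vertex c t ≡ v

      covered? : ∀ v → Dec (Any (Covered v) chosen)
      covered? v = Any.any? (λ c → any? λ t → vertex c t ≟ v) chosen

      -- From one centre to `u`, across to `v`, and on to the other centre takes at most
      -- `R + (R + R) + R` steps; this is a summand of `Δ`.
      covered-unique : ∀ {c c′ u v} → c ∈ chosen → c′ ∈ chosen → Covered u c → Covered v c′ →
                       Near G (R + R) u v → c ≡ c′
      covered-unique {c} {c′} c∈ c′∈ (t , refl) (t′ , refl) p = equal-or-far c∈ c′∈
        (near-mono 4R≤Δ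
          (near-trans (near-trans (Realises.nearby (realised c) t) p)
                      (near-sym (Realises.nearby (realised c′) t′))))

      partialColour : Colouring {G = G} (Fin hues)
      partialColour v with covered? v
      ... | yes some = let (c , _ , t , _) = find some in just (hue (proj₁ (proj₂ (template c))) t)
      ... | no _     = nothing

      partial-proper : Proper {G = G} (R + R) partialColour
      partial-proper {u} {v} eu ev p with covered? u | covered? v
      ... | yes some | yes some′ with find some | find some′
      ... | c , c∈ , t , tu | c′ , c′∈ , t′ , tv
        with covered-unique c∈ c′∈ (t , tu) (t′ , tv) p
      ... | refl = ≡-trans (sym tu) (≡-trans (cong (vertex c)
                     (Realises.hue-inj (realised c) t t′ (just-injective (≡-trans eu (sym ev))))) tv)

      partial-covered : ∀ {c} → c ∈ chosen → ∀ t →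
                        partialColour (vertex c t) ≡ just (hue (proj₁ (proj₂ (template c))) t)
      partial-covered {c} c∈ t with covered? (vertex c t)
      ... | no none  = contradiction (lose c∈ (t , refl)) none
      ... | yes some with find some
      ... | c′ , c′∈ , t′ , e with covered-unique c′∈ c∈ (t′ , e) (t , refl) stay
      ... | refl = cong (just ∘ hue (proj₁ (proj₂ (template c))))
                     (Embedding.injective (Realises.embeds (realised c)) t′ t e)

      support : List (Fin n)
      support = concatMap (ball {G = G} (suc top)) (map proj₂ sources)

      supported : ∀ {v} → 0 < depth v → v ∈ support
      supported pos = let ((h , u) , s∈ , p) = deepest-pos {G = G} sources pos in
        ∈-concatMap⁺ (ball (suc top))
          (lose (∈-map⁺ proj₂ s∈) (near⇒∈ball (near-mono (source≤ s∈) p)))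

      length-support : length support ≤ (length X + length chosen) * ballSize d (suc top)
      length-support = ≤-trans
        (length-concatMap≤ (ball (suc top)) (length-ball deg (suc top)) (map proj₂ sources))
        (*-monoˡ-≤ (ballSize d (suc top)) (≤-reflexive
          (≡-trans (length-map proj₂ sources) (≡-trans (length-++ (map (suc top ,_) X))
            (cong₂ _+_ (length-map (suc top ,_) X) (length-map (λ c → stage c , centre c) chosen))))))

    module Tabulation
      (depth : Fin n → ℕ) (depth≤ : ∀ v → depth v ≤ suc top)
      (depth-lipschitz : ∀ {u v} → E G u v ≡ true → depth u ≤ suc (depth v))
      (sign : Fin n → Bool) (colour : Fin n → Fin hues)
      (colour-inj : ∀ {u v} → colour u ≡ colour v → Near G (R + R) u v → u ≡ v) where

      vs : List (Fin n)
      vs = filter (λ v → 0 <? depth v) (allFin n)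

      x : Fin (length vs) → Fin n
      x = lookup vs

      x-deep : ∀ p → 0 < depth (x p)
      x-deep p = proj₂ (∈-filter⁻ (λ v → 0 <? depth v) {xs = allFin n} (∈-lookup p))

      x-listed : ∀ {v} → 0 < depth v → ∃ λ p → x p ≡ v
      x-listed {v} pos = let v∈ = ∈-filter⁺ (λ v → 0 <? depth v) (∈-allFin v) pos
                         in index v∈ , sym (lookup-index v∈)

      x-injective : ∀ {p q} → x p ≡ x q → p ≡ q
      x-injective = unique⇒lookup-injective (filter⁺ (λ v → 0 <? depth v) (allFin⁺ n))

      open MakeTable (λ p q → E G (x p) (x q)) (λ ℓ p → P G ℓ (x p)) (λ p → depth (x p) ∸ 1)
                     (λ p → ∸-monoˡ-≤ 1 (depth≤ (x p))) (λ p → colour (x p)) (λ p → sign (x p)) public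

      suc-rank : ∀ p → suc (rank table p) ≡ depth (x p)
      suc-rank p = ≡-trans (cong suc (rank-table p)) (m+[n∸m]≡n (x-deep p))

      table≤ : ∀ ys → (∀ {v} → 0 < depth v → v ∈ ys) → length vs ≤ length ys
      table≤ ys sub = unique⊆⇒length≤ (filter⁺ (λ v → 0 <? depth v) (allFin⁺ n))
        λ v∈ → sub (proj₂ (∈-filter⁻ (λ v → 0 <? depth v) {xs = allFin n} v∈))

      embedded : Embedding G table x
      embedded = record
        { injective = λ _ _ → x-injective
        ; adj-≡     = λ p q → sym (adj-table p q)
        ; pred-≡    = λ ℓ p → sym (pred-table ℓ p)
        ; closed    = λ p pos v pv →
            let lip     = depth-lipschitz pv
                (q , e) = x-listed (s≤s⁻¹ (≤-trans (s≤s pos) (≤-trans (≤-reflexive (suc-rank p)) lip)))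
            in q , e , s≤s⁻¹ (subst₂ (λ a b → a ≤ suc b) (sym (suc-rank p))
                 (≡-trans (cong depth (sym e)) (sym (suc-rank q))) lip) }

      planting : ∀ c → depth (centre c) ≡ stage c → sign (centre c) ≡ proj₂ (proj₂ (slot c)) →
        (∀ t → colour (vertex c t) ≡ hue (proj₁ (proj₂ (template c))) t) →
        Planted G table x (template c) (proj₁ (proj₂ (slot c))) (proj₂ (proj₂ (slot c))) (vertex c)
      planting c depth-c sign-c colour-c = record
        { realised = realised c
        ; placed   = let (p , e) = x-listed (subst (0 <_) (sym depth-c) (s≤s z≤n)) in
            p , e , suc-injective (≡-trans (suc-rank p) (≡-trans (cong depth e) depth-c)) ,
            ≡-trans (side-table p) (≡-trans (cong sign e) sign-c)
        ; coloured = λ t → let (p , e) = x-listed (deep t) in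
            p , e , ≡-trans (hue-table p) (≡-trans (cong colour e) (colour-c t)) }
        where
        -- The centre has depth above `R`, since levels start at `R`, and at most `R` is lost on the
        -- way to `vertex c t`.
        deep : ∀ t → 0 < depth (vertex c t)
        deep t with depth (vertex c t) | near-lipschitz {f = depth} depth-lipschitz
                                           (Realises.nearby (realised c) t)
        ... | suc _ | _ = s≤s z≤n
        ... | zero  | h = contradiction
          (≤-trans (≤-reflexive (sym depth-c)) (≤-trans h (≤-reflexive (+-identityʳ R))))
          (<⇒≱ (s≤s (m≤m+n R _)))

      rare-in-table : ∀ {q} → (∀ v → RealisedAt q v → depth v ≡ suc top) → Rare G table x q
      rare-in-table rare (y , r , none) =
        let depth-y = rare _ (y , r , refl)
            (p , e) = x-listed (subst (0 <_) (sym depth-y) (s≤s z≤n))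
        in none (p , e , s≤s⁻¹ (≤-reflexive (sym (≡-trans (suc-rank p) (≡-trans (cong depth e) depth-y)))))

      goodTable : (∀ q → q ∈ templates → Rare G table x q ⊎ (∀ i s → s ∈ bools → ∃ (Planted G table x q i s))) →
                  Good G table x templates
      goodTable coded = record
        { embeds = embedded
        ; proper = λ p q near e → x-injective (colour-inj
                     (subst₂ _≡_ (hue-table p) (hue-table q) e) near)
        ; coded  = coded }

    -- The covering bound is the number of slots, as up to that many mutually far copies must be
    -- found outside the core.
    hasGoodTable : ∃ λ m → m ≤ tableSize × ∃ λ (D : Table m) → ∃ λ x → Good G D x templates
    hasGoodTable with core deg (length slots) (length templates) templates ≤-refl []
    ... | X , _ , X≤ , coded with choose slots X
    ... | chosen , chosen≤ , X-far , fars , all = length T.vs ,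
      ≤-trans (T.table≤ A.support A.supported)
        (≤-trans A.length-support (*-monoˡ-≤ (ballSize d (suc top)) (+-mono-≤ X≤ chosen≤))) ,
      T.table , T.x , T.goodTable λ q q∈ → code q q∈ (coded q∈)
      where
      module A = Assignment X chosen X-far fars

      extension = extendColouring {G = G} {r = R + R} (length-ball deg (R + R))
                    A.partialColour A.partial-proper

      module T = Tabulation A.depth A.depth≤ (deepest-lipschitz {G = G} A.sources) A.sign
                   (proj₁ extension) (proj₂ (proj₂ extension))

      code : ∀ q → q ∈ templates → (∀ v → RealisedAt q v → v ∈ X) ⊎ ¬ Coverable (length slots) q X →
             Rare G T.table T.x q ⊎ (∀ i s → s ∈ bools → ∃ (Planted G T.table T.x q i s))
      code q q∈ (inj₁ rare) = inj₁ (T.rare-in-table λ v r → A.depth-X (rare v r))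
      code q q∈ (inj₂ free) = inj₂ λ i s s∈ → plant i s s∈
        where
        plant : ∀ i s → s ∈ bools → ∃ (Planted G T.table T.x q i s)
        plant i s s∈ with all (∈-slots q∈ s∈) free
        ... | c , c∈ , refl = vertex c , T.planting c (A.depth-centre c∈) (A.sign-centre c∈)
                                λ t → proj₁ (proj₂ extension) (A.partial-covered c∈ t)

-- The first-order sentence

module _ (N d : ℕ) {K : ℕ} (φ : CFO N [] K) where
  open Soundness N d K
  open Completeness N d K using (templates; tableSize; hasGoodTable)

  translation : FO N 0
  translation = orOver (upTo (suc tableSize)) λ m → orOver (tables m) λ D →
    and' (dec' (evalR D emptyEnv φ ≟ᵇ true)) (exBlock m (good' D (_↑ˡ 0) templates))

  translation-expresses : ∀ {n} (G : Graph N n) → Expresses G (λ ()) translation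
    (∃ λ m → m ∈ upTo (suc tableSize) × ∃ λ D → D ∈ tables m ×
       evalR D emptyEnv φ ≡ true × ∃ λ x → Good G D x templates)
  translation-expresses G = orOver-expresses _ λ m → orOver-expresses _ λ D →
    and-expresses (dec-expresses _) (exBlock-expresses m λ y ρ new old →
      good-expresses D templates new)

  translation-correct : OrderInvariant φ → ∀ {n} (G : Graph N n) → (∀ v → degree G v ≤ d) →
                        ∀ o → (G , o ⊨CFO φ) ≡ (G ⊨FO translation)
  translation-correct invariant G deg o = bool-ext to from
    where
    -- Here order-invariance enters. Every good table in `G` gives the right verdict, not only the
    -- constructed one, so the mere existence of an accepting one is conclusive.
    table-decides : ∀ {m D x} → Good {m} G D x templates → (G , o ⊨CFO φ) ≡ evalR D emptyEnv φ
    table-decides {m} {D} {x} gd =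
      ≡-trans (invariant G o (Bounded.Structure.order deg gd)) (Game.sound N d K deg gd φ)

    to : (G , o ⊨CFO φ) ≡ true → (G ⊨FO translation) ≡ true
    to h = let (m , m≤ , D , x , gd) = hasGoodTable deg in
      reflects-true (reflects (translation-expresses G))
        (m , ∈-upTo⁺ (s≤s m≤) , D , ∈-tables D , ≡-trans (sym (table-decides gd)) h , x , gd)

    from : (G ⊨FO translation) ≡ true → (G , o ⊨CFO φ) ≡ true
    from h = let (_ , _ , _ , _ , holds , _ , gd) = true-reflects (reflects (translation-expresses G)) h
             in ≡-trans (table-decides gd) holds

mainTheorem1 : (N d : ℕ) (C : ∀ {n} → Graph N n → Set) →
    (∀ {n} (G : Graph N n) → C G → ∀ (v : Fin n) → degree G v ≤ d) →
    ∀ (k : ℕ) (φ : CFO N [] k) → OrderInvariant φ →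
    Σ (FO N 0) λ ψ →
    ∀ {n} (G : Graph N n) → C G → ∀ (o : LinOrder n) →
    (G , o ⊨CFO φ) ≡ (G ⊨FO ψ)
mainTheorem1 N d C bounded k φ invariant =
  translation N d φ , λ G cG o → translation-correct N d φ invariant G (bounded G cG) o
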